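{- Let $n$ be a positive integer with prime factorization \[ n=3^{a}5^{b}\prod_{i=1}^{r}p_i^{v_i}\prod_{j=1}^{s}q_j^{w_j}, \] where each $p_i\equiv 1\pmod 3$ and each $q_j\neq 5$ satisfies $q_j\equiv 2\pmod 3$. Define $\Lambda(n)=\prod_{i=1}^{r}(1+v_i)\prod_{j=1}^{s}\frac{1+(-1)^{w_j}}{2}$, and let $t$ be the number of prime factors of $n$, counted with multiplicity, that are congruent to $7$ or $13\pmod{15}$. Then \[ (1,1,19;n)=\begin{cases}(1+(-1)^{a+t})\Lambda(n), & b=0,\\ 0, & b \text{ odd},\\ 6\Lambda(n), & b>0,\ b \text{ even},\end{cases} \qquad (3,3,7;n)=\begin{cases}(1-(-1)^{a+t})\Lambda(n), & b=0,\\ 0, & b \text{ odd},\\ 6\Lambda(n), & b>0,\ b \text{ even}.\end{cases} \]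
   Context: For a binary quadratic form $(a,b,c)$, i.e. $ax^2+bxy+cy^2$, the quantity $(a,b,c;n)$ denotes the number of pairs $(x,y)\in\mathbb{Z}^2$ with $ax^2+bxy+cy^2=n$. -}

module Defs where

open import Data.Bool.Base using (Bool; true; false; if_then_else_; _∧_; _∨_; not)
open import Data.Nat.Base as ℕ using (ℕ; zero; suc; _%_; _≡ᵇ_)
open import Data.Integer.Base using (ℤ; +_; -_; _+_; _-_; _*_; _^_)
open import Data.List.Base using (List; []; _∷_; foldr; map; upTo)
open import Data.Nat.Primality using (prime?)
open import Data.Product.Base using (Σ; _×_)
open import Relation.Nullary.Decidable.Core using (does)
open import Relation.Binary.PropositionalEquality using (_≡_)

form : ℤ → ℤ → ℤ → ℤ → ℤ → ℤ
form a b c x y = a * (x * x) + b * (x * y) + c * (y * y)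

-- The set of representations of n by (a,b,c): pairs (x,y) ∈ ℤ² with a x²+bxy+cy² = n.
-- (a,b,c;n) = k is expressed as a bijection of this type with Fin k.
Reps : ℤ → ℤ → ℤ → ℤ → Set
Reps a b c n = Σ (ℤ × ℤ) (λ xy → form a b c (Σ.proj₁ xy) (Σ.proj₂ xy) ≡ n)

mult : ℕ → List ℕ → ℕ
mult p []       = 0
mult p (q ∷ qs) = if p ≡ᵇ q then suc (mult p qs) else mult p qs

countT : List ℕ → ℕ
countT []       = 0
countT (q ∷ qs) = if (q % 15 ≡ᵇ 7) ∨ (q % 15 ≡ᵇ 13) then suc (countT qs) else countT qs

isEven : ℕ → Bool
isEven w = w % 2 ≡ᵇ 0

-- (1 + (-1)^w) / 2
halfSign : ℕ → ℤ
halfSign w = if isEven w then + 1 else + 0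

lamFactor : List ℕ → ℕ → ℤ
lamFactor ps p =
  if does (prime? p) ∧ (p % 3 ≡ᵇ 1) then + 1 + + mult p ps
  else if does (prime? p) ∧ (p % 3 ≡ᵇ 2) ∧ not (p ≡ᵇ 5) then halfSign (mult p ps)
  else + 1

productℤ : List ℤ → ℤ
productℤ = foldr _*_ (+ 1)

-- Λ(n), with ps the prime factorization of n; every prime factor of n is ≤ n,
-- and primes not dividing n contribute a factor 1.
Λ : ℕ → List ℕ → ℤ
Λ n ps = productℤ (map (lamFactor ps) (upTo (suc n)))

byB : ℕ → ℤ → ℤ → ℤ
byB zero    caseZero caseEvenPos = caseZero
byB (suc b) caseZero caseEvenPos = if isEven (suc b) then caseEvenPos else + 0

rhs1-1-19 : ℕ → List ℕ → ℤ
rhs1-1-19 n ps =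
  byB (mult 5 ps)
      ((+ 1 + (- + 1) ^ (mult 3 ps ℕ.+ countT ps)) * Λ n ps)
      (+ 6 * Λ n ps)

rhs3-3-7 : ℕ → List ℕ → ℤ
rhs3-3-7 n ps =
  byB (mult 5 ps)
      ((+ 1 - (- + 1) ^ (mult 3 ps ℕ.+ countT ps)) * Λ n ps)
      (+ 6 * Λ n ps)

{-# OPTIONS --safe #-}
module Submission where

-- Both forms are the norm form N(x,y) = x² + xy + y² of ℤ[ζ], ζ a primitive sixth root of unity, restricted to
-- a sublattice of index 5:  x² + xy + 19y² = N(x - 2y, 5y)  and  3x² + 3xy + 7y² = N(x - 2y, x + 3y).
-- The six sublattices of index 5 are the lines of 𝔽₅² and form two orbits of size 3 under the rotation ω = ζ²;
-- on the lines of one orbit N takes square values mod 5, on those of the other non-squares.  Hence, if 5 ∤ n,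
-- one form represents n a third as often as N does and the other one not at all, according to the character
-- of n mod 5.  As 5 is inert, 5 ∣ N(u) forces 5 ∣ u, so if 5 ∣ n every element of norm n lies in both lattices.
--
-- That N represents n exactly 6 Λ(n) times (b even) follows by splitting off one prime power at a time.  A prime p
-- dividing N(u) but not u is itself a norm, by descent; for p ≡ 2 (mod 3) this is impossible mod 3, and for
-- p ≡ 1 (mod 3) such a u comes from a fixed point of the order-3 map X ↦ 1/(1 - X) on the p - 2 elements
-- of 𝔽ₚ ∖ {0,1}.

open import Defs
open import Data.Bool.Base using (Bool; true; false; not; if_then_else_; _∧_; _∨_; T)
open import Data.Empty using (⊥-elim)
open import Data.Fin.Base as Fin using (Fin; zero; suc; toℕ)
import Data.Fin.Permutation as Perm
import Data.Fin.Properties as Fin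
open import Data.Integer.Base as ℤ using (ℤ; +_; -_; _+_; _-_; _*_; _^_; 0ℤ; 1ℤ)
import Data.Integer.DivMod as ℤ
open import Data.Integer.Divisibility.Signed using (_∣_; divides; _∣?_; ∣⇒∣ᵤ; ∣ᵤ⇒∣; ∣m∣n⇒∣m+n; ∣m∣n⇒∣m-n; ∣m⇒∣m*n; ∣n⇒∣m*n; ∣-refl)
import Data.Integer.Properties as ℤ
open import Data.Integer.Tactic.RingSolver using (solve-∀)
open import Data.List.Base using (List; []; _∷_; map; upTo; _∷ʳ_)
import Data.List.Properties as List
open import Data.List.Relation.Unary.All as All using (All; []; _∷_)
import Data.List.Relation.Unary.All.Properties as All
open import Data.Nat.Base as ℕ using (ℕ; zero; suc; _≡ᵇ_; _%_; _<_)
open import Data.Nat.Coprimality using (coprime-Bézout; prime⇒coprime)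
import Data.Nat.Divisibility as ℕ
import Data.Nat.DivMod as ℕ
open import Data.Nat.GCD using (module Bézout)
open import Data.Nat.Induction using (<-rec)
open import Data.Nat.ListAction using (product)
open import Data.Nat.ListAction.Properties using (∈⇒∣product)
open import Data.Nat.Primality using (Prime; prime?; euclidsLemma; prime⇒irreducible; prime⇒nonZero; ¬prime[0]; ¬prime[1]; productOfPrimes≢0)
import Data.Nat.Properties as ℕ
import Data.Nat.Tactic.RingSolver as ℕRing
open import Data.Product.Base using (Σ; _×_; _,_; proj₁; proj₂; ∃; ∃₂)
open import Data.Product.Function.NonDependent.Propositional using (_×-↔_)
open import Data.Sum.Base as Sum using (_⊎_; inj₁; inj₂; [_,_])
open import Data.Sum.Function.Propositional using (_⊎-↔_)
open import Function.Base using (_∘_; id)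
open import Function.Bundles using (_↔_; Inverse; mk⤖; mk↔ₛ′)
open import Function.Consequences.Propositional using (strictlySurjective⇒surjective)
open import Function.Construct.Composition using (_↔-∘_)
open import Function.Construct.Identity using (↔-id)
open import Function.Construct.Symmetry using (↔-sym)
open import Function.Properties.Bijection using (⤖⇒↔)
open import Relation.Binary.Definitions using (tri<; tri≈; tri>)
open import Relation.Binary.PropositionalEquality using (_≡_; _≢_; refl; sym; trans; cong; cong₂; subst; subst₂; module ≡-Reasoning)
open import Relation.Binary.PropositionalEquality.WithK using (≡-irrelevant)
open import Relation.Nullary.Decidable using (Dec; yes; no; does; from-yes; dec-true; dec-false; ¬?; _×-dec_; _⊎-dec_; _→-dec_)
open import Relation.Nullary.Negation.Core using (¬_)

-- Finite types, subsets, and orbits of a map of order 3.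

bijective⇒↔ : {A B : Set} (f : A → B) → (∀ {x y} → f x ≡ f y → x ≡ y) →
              (∀ y → Σ A λ x → f x ≡ y) → A ↔ B
bijective⇒↔ f inj surj = ⤖⇒↔ (mk⤖ (inj , strictlySurjective⇒surjective surj))

empty↔Fin0 : {A : Set} → ¬ A → A ↔ Fin 0
empty↔Fin0 ¬a = mk↔ₛ′ (⊥-elim ∘ ¬a) (λ ()) (λ ()) (⊥-elim ∘ ¬a)

from-does : {A : Set} (a? : Dec A) → does a? ≡ true → A
from-does (yes a) _ = a

-- Membership is a Boolean equation, so its proofs are unique and each index is counted at most
-- once.
finite-subset : ∀ {K} (b : Fin K → Bool) →
                Σ ℕ λ k → Σ (Fin K) (λ i → b i ≡ true) ↔ Fin k
finite-subset {zero} b = 0 , empty↔Fin0 λ ()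
finite-subset {suc K} b with finite-subset (b ∘ suc) | b zero in b₀
... | k , e | true = suc k , mk↔ₛ′ to from to∘from from∘to
  where
  module e = Inverse e
  to : Σ (Fin (suc K)) (λ i → b i ≡ true) → Fin (suc k)
  to (zero , _) = zero
  to (suc i , p) = suc (e.to (i , p))
  from : Fin (suc k) → Σ (Fin (suc K)) (λ i → b i ≡ true)
  from zero = zero , b₀
  from (suc j) = let (i , p) = e.from j in suc i , p
  to∘from : ∀ j → to (from j) ≡ j
  to∘from zero = refl
  to∘from (suc j) = cong suc (e.strictlyInverseˡ j)
  from∘to : ∀ x → from (to x) ≡ x
  from∘to (zero , p) = cong (zero ,_) (≡-irrelevant _ _)
  from∘to (suc i , p) = cong (λ (i , p) → suc i , p) (e.strictlyInverseʳ (i , p))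
... | k , e | false = k , mk↔ₛ′ to from to∘from from∘to
  where
  module e = Inverse e
  to : Σ (Fin (suc K)) (λ i → b i ≡ true) → Fin k
  to (zero , p) with () ← trans (sym p) b₀
  to (suc i , p) = e.to (i , p)
  from : Fin k → Σ (Fin (suc K)) (λ i → b i ≡ true)
  from j = let (i , p) = e.from j in suc i , p
  to∘from : ∀ j → to (from j) ≡ j
  to∘from j = e.strictlyInverseˡ j
  from∘to : ∀ x → from (to x) ≡ x
  from∘to (zero , p) with () ← trans (sym p) b₀
  from∘to (suc i , p) = cong (λ (i , p) → suc i , p) (e.strictlyInverseʳ (i , p))

-- The copy {0} × X of X inside Fin 3 × X is cut out by a decidable condition.
divide-card-by-3 : ∀ {X : Set} {K} → (Fin 3 × X) ↔ Fin K →
                   Σ ℕ λ k → (X ↔ Fin k) × K ≡ 3 ℕ.* k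
divide-card-by-3 {X} {K} e =
  let k , s = finite-subset is-zero
      X↔k = s ↔-∘ bijective⇒↔ ι ι-injective ι-surjective
  in k , X↔k ,
     Perm.↔⇒≡ (↔-sym Fin.*↔× ↔-∘ ((↔-id _ ×-↔ X↔k) ↔-∘ ↔-sym e))
  where
  module e = Inverse e
  zero? : Fin 3 → Bool
  zero? zero = true
  zero? (suc _) = false
  is-zero : Fin K → Bool
  is-zero i = zero? (proj₁ (e.from i))
  ι : X → Σ (Fin K) λ i → is-zero i ≡ true
  ι x = e.to (zero , x) , cong (zero? ∘ proj₁) (e.strictlyInverseʳ (zero , x))
  ι-injective : ∀ {x y} → ι x ≡ ι y → x ≡ y
  ι-injective {x} {y} eq = cong proj₂ (trans (sym (e.strictlyInverseʳ (zero , x)))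
    (trans (cong (e.from ∘ proj₁) eq) (e.strictlyInverseʳ (zero , y))))
  Σ-≡ : ∀ {i j} {p : is-zero i ≡ true} {q : is-zero j ≡ true} → i ≡ j → (i , p) ≡ (j , q)
  Σ-≡ refl = cong (_ ,_) (≡-irrelevant _ _)
  preimage : ∀ u → zero? (proj₁ u) ≡ true → Σ X λ x → (zero , x) ≡ u
  preimage (zero , x) _ = x , refl
  ι-surjective : ∀ s → Σ X λ x → ι x ≡ s
  ι-surjective (i , p) =
    let x , eq = preimage (e.from i) p
    in x , Σ-≡ (trans (cong e.to eq) (e.strictlyInverseˡ i))

-- `X` is a transversal of free orbits, and `(i , x)` goes to the `i`-th translate of `ι x`. As `σ`
-- has order 3, disjointness of the image of `ι` from its first translate yields all the other
-- cases. In the covering condition `ι x ≡ σ t` means that `t` lies in the second translate, and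
-- `ι x ≡ σ (σ t)` that it lies in the first.
orbits↔ : {T X : Set} (σ : T → T) → (∀ t → σ (σ (σ t)) ≡ t) →
          (ι : X → T) → (∀ {x y} → ι x ≡ ι y → x ≡ y) →
          (∀ x y → ι x ≢ σ (ι y)) →
          (∀ t → Σ X λ x → (ι x ≡ t ⊎ ι x ≡ σ t) ⊎ ι x ≡ σ (σ t)) →
          (Fin 3 × X) ↔ T
orbits↔ {T} {X} σ σ³ ι ι-inj disjoint cover = bijective⇒↔ f (f-inj _ _) f-surj
  where
  f : Fin 3 × X → T
  f (zero , x) = ι x
  f (suc zero , x) = σ (ι x)
  f (suc (suc zero) , x) = σ (σ (ι x))
  σ-inj : ∀ {s t} → σ s ≡ σ t → s ≡ t
  σ-inj {s} {t} eq = trans (sym (σ³ s)) (trans (cong (σ ∘ σ) eq) (σ³ t))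
  f-inj : ∀ u v → f u ≡ f v → u ≡ v
  f-inj (zero , x) (zero , y) eq = cong (zero ,_) (ι-inj eq)
  f-inj (zero , x) (suc zero , y) eq = ⊥-elim (disjoint x y eq)
  f-inj (zero , x) (suc (suc zero) , y) eq = ⊥-elim (disjoint y x (sym (trans (cong σ eq) (σ³ _))))
  f-inj (suc zero , x) (zero , y) eq = ⊥-elim (disjoint y x (sym eq))
  f-inj (suc zero , x) (suc zero , y) eq = cong (suc zero ,_) (ι-inj (σ-inj eq))
  f-inj (suc zero , x) (suc (suc zero) , y) eq = ⊥-elim (disjoint x y (σ-inj eq))
  f-inj (suc (suc zero) , x) (zero , y) eq = ⊥-elim (disjoint x y (trans (sym (σ³ _)) (cong σ eq)))
  f-inj (suc (suc zero) , x) (suc zero , y) eq = ⊥-elim (disjoint y x (sym (σ-inj eq)))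
  f-inj (suc (suc zero) , x) (suc (suc zero) , y) eq = cong (suc (suc zero) ,_) (ι-inj (σ-inj (σ-inj eq)))
  f-surj : ∀ t → Σ (Fin 3 × X) λ u → f u ≡ t
  f-surj t with cover t
  ... | x , inj₁ (inj₁ eq) = (zero , x) , eq
  ... | x , inj₁ (inj₂ eq) = (suc (suc zero) , x) , trans (cong (σ ∘ σ) eq) (σ³ t)
  ... | x , inj₂ eq = (suc zero , x) , trans (cong σ eq) (σ³ t)

-- Each orbit is represented by its minimum.
order-3-fixed-point : ∀ {K} (σ : Fin K → Fin K) → (∀ i → σ (σ (σ i)) ≡ i) →
                      (∃ λ i → σ i ≡ i) ⊎ (∃ λ k → K ≡ 3 ℕ.* k)
order-3-fixed-point {K} σ σ³ with Fin.any? (λ i → σ i Fin.≟ i)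
... | yes fixed = inj₁ fixed
... | no free = inj₂ (let k , _ , eq = divide-card-by-3 (orbits↔ σ σ³ proj₁ ι-inj disjoint cover) in k , eq)
  where
  min? : ∀ i → Dec (i Fin.< σ i × i Fin.< σ (σ i))
  min? i = (i Fin.<? σ i) ×-dec (i Fin.<? σ (σ i))
  X : Set
  X = Σ (Fin K) λ i → does (min? i) ≡ true
  ι-inj : {x y : X} → proj₁ x ≡ proj₁ y → x ≡ y
  ι-inj {i , p} {.i , q} refl = cong (i ,_) (≡-irrelevant p q)
  min : (x : X) → let i = proj₁ x in i Fin.< σ i × i Fin.< σ (σ i)
  min (i , p) = from-does (min? i) p
  mk : ∀ i → i Fin.< σ i → i Fin.< σ (σ i) → X
  mk i p q = i , dec-true (min? i) (p , q)
  disjoint : ∀ x y → proj₁ x ≢ σ (proj₁ y)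
  disjoint x y eq = ℕ.<-asym (subst (proj₁ y Fin.<_) (sym eq) (proj₁ (min y)))
    (subst (proj₁ x Fin.<_) (trans (cong (σ ∘ σ) eq) (σ³ _)) (proj₂ (min x)))
  neq : ∀ i → σ i ≢ i
  neq i eq = free (i , eq)
  cover : ∀ t → Σ X λ x → (proj₁ x ≡ t ⊎ proj₁ x ≡ σ t) ⊎ proj₁ x ≡ σ (σ t)
  cover t with Fin.<-cmp t (σ t) | Fin.<-cmp (σ t) (σ (σ t)) | Fin.<-cmp t (σ (σ t))
  ... | tri≈ _ eq _ | _ | _ = ⊥-elim (neq t (sym eq))
  ... | _ | tri≈ _ eq _ | _ = ⊥-elim (neq (σ t) (sym eq))
  ... | _ | _ | tri≈ _ eq _ = ⊥-elim (neq t (trans (cong σ eq) (σ³ t)))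
  ... | tri< a _ _ | _ | tri< b _ _ = mk t a b , inj₁ (inj₁ refl)
  ... | tri> _ _ a | tri< b _ _ | _ = mk (σ t) b (subst (σ t Fin.<_) (sym (σ³ t)) a) , inj₁ (inj₂ refl)
  ... | _ | tri> _ _ b | tri> _ _ c = mk (σ (σ t)) (subst (σ (σ t) Fin.<_) (sym (σ³ t)) c)
                                         (subst (σ (σ t) Fin.<_) (sym (cong σ (σ³ t))) b) , inj₂ refl
  ... | tri< a _ _ | tri< b _ _ | tri> _ _ c = ⊥-elim (ℕ.<-asym (ℕ.<-trans a b) c)
  ... | tri> _ _ a | tri> _ _ b | tri< c _ _ = ⊥-elim (ℕ.<-asym (ℕ.<-trans b a) c)

-- The norm form and Fermat descent to prime norms.

N : ℤ → ℤ → ℤ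
N x y = x * x + x * y + y * y

Nℕ : ℕ → ℕ → ℕ
Nℕ r d = r ℕ.* r ℕ.+ r ℕ.* d ℕ.+ d ℕ.* d

pos-N : ∀ r d → + Nℕ r d ≡ N (+ r) (+ d)
pos-N r d = cong₂ _+_ (cong₂ _+_ (ℤ.pos-* r r) (ℤ.pos-* r d)) (ℤ.pos-* d d)

Nℕ-< : ∀ r d k → r ℕ.+ d ℕ.< k → Nℕ r d ℕ.< k ℕ.* k
Nℕ-< r d k lt = ℕ.≤-<-trans bound (ℕ.*-mono-< lt lt)
  where
  square : ∀ r d → (r ℕ.+ d) ℕ.* (r ℕ.+ d) ≡ (r ℕ.* r ℕ.+ r ℕ.* d ℕ.+ d ℕ.* d) ℕ.+ r ℕ.* d
  square = ℕRing.solve-∀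
  bound : Nℕ r d ℕ.≤ (r ℕ.+ d) ℕ.* (r ℕ.+ d)
  bound rewrite square r d = ℕ.m≤m+n _ _

Nℕ≡0 : ∀ r d → Nℕ r d ≡ 0 → r ≡ 0 × d ≡ 0
Nℕ≡0 zero zero _ = refl , refl

-- Remainders of `x` and `y` modulo `k` whose norm stays below `k²`; two nonnegative remainders
-- below `k` would only guarantee a bound of `3k²`.
record Reduction (k : ℕ) (x y : ℤ) : Set where
  field
    q q′    : ℤ
    r s     : ℤ
    m       : ℕ
    x≡      : x ≡ r + q * + k
    y≡      : y ≡ s + q′ * + k
    Nrs     : N r s ≡ + m
    m<k²    : m ℕ.< k ℕ.* k
    m≡0⇒r,s≡0 : m ≡ 0 → r ≡ 0ℤ × s ≡ 0ℤ

-- With 0 ≤ r, t < k one has N r (- t) = r² - rt + t² ≤ max(r,t)² < k².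
small-norm : ∀ k r t → r ℕ.< k → t ℕ.< k →
  ∃ λ m → N (+ r) (- + t) ≡ + m × m ℕ.< k ℕ.* k × (m ≡ 0 → + r ≡ 0ℤ × - + t ≡ 0ℤ)
small-norm k r t r<k t<k with ℕ.≤-total r t
... | inj₁ r≤t with d , refl ← ℕ.m≤n⇒∃[o]m+o≡n r≤t =
  Nℕ r d , trans (norm (+ r) (+ d)) (sym (pos-N r d)) , Nℕ-< r d k t<k ,
  λ eq → let r≡0 , d≡0 = Nℕ≡0 r d eq in
    cong +_ r≡0 , cong (-_ ∘ +_) (cong₂ ℕ._+_ r≡0 d≡0)
  where
  norm : ∀ r d → r * r + r * - (r + d) + - (r + d) * - (r + d) ≡ r * r + r * d + d * d
  norm = solve-∀
... | inj₂ t≤r with d , refl ← ℕ.m≤n⇒∃[o]m+o≡n t≤r =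
  Nℕ t d , trans (norm (+ t) (+ d)) (sym (pos-N t d)) , Nℕ-< t d k r<k ,
  λ eq → let t≡0 , d≡0 = Nℕ≡0 t d eq in
    cong +_ (cong₂ ℕ._+_ t≡0 d≡0) , cong (-_ ∘ +_) t≡0
  where
  norm : ∀ t d → (t + d) * (t + d) + (t + d) * - t + - t * - t ≡ t * t + t * d + d * d
  norm = solve-∀

-- Dividing `- y` instead of `y` makes `s` nonpositive while `r` is nonnegative. The mixed term
-- `r * s` then lowers the norm, as `small-norm` requires.
reduction : ∀ k .{{_ : ℕ.NonZero k}} x y → Reduction k x y
reduction k x y =
  let m , Nrs , m<k² , m≡0⇒ = small-norm k _ _ (ℤ.n%ℕd<d x k) (ℤ.n%ℕd<d (- y) k)
  in record
  { q = x ℤ./ℕ k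
  ; q′ = - ((- y) ℤ./ℕ k)
  ; r = + (x ℤ.%ℕ k)
  ; s = - + ((- y) ℤ.%ℕ k)
  ; m = m
  ; x≡ = ℤ.a≡a%ℕn+[a/ℕn]*n x k
  ; y≡ = trans (sym (ℤ.neg-involutive y))
           (trans (cong -_ (ℤ.a≡a%ℕn+[a/ℕn]*n (- y) k)) (neg (+ ((- y) ℤ.%ℕ k)) ((- y) ℤ./ℕ k) (+ k)))
  ; Nrs = Nrs
  ; m<k² = m<k²
  ; m≡0⇒r,s≡0 = m≡0⇒
  }
  where
  neg : ∀ t q k → - (t + q * k) ≡ - t + (- q) * k
  neg = solve-∀

N-reduce : ∀ r q s q′ k → N r s ≡ N (r + q * k) (s + q′ * k) -
  ((+ 2 * r + q * k + s) * q + (r + q * k + + 2 * s + q′ * k) * q′) * k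
N-reduce = aux
  where
  aux : ∀ r q s q′ k → r * r + r * s + s * s ≡
    (r + q * k) * (r + q * k) + (r + q * k) * (s + q′ * k) + (s + q′ * k) * (s + q′ * k) -
    ((+ 2 * r + q * k + s) * q + (r + q * k + + 2 * s + q′ * k) * q′) * k
  aux = solve-∀

reduction-∣ : ∀ {k x y} (ρ : Reduction k x y) → + k ∣ N x y → ∃ λ k′ → Reduction.m ρ ≡ k′ ℕ.* k
reduction-∣ {k} {x} {y} ρ (divides c eq) =
  let ℕ.divides k′ m≡ = ∣⇒∣ᵤ {+ k} {+ m} k∣m in k′ , m≡
  where
  open Reduction ρ
  k∣m : + k ∣ + m
  k∣m = subst (+ k ∣_) (trans (sym (N-reduce r q s q′ (+ k)))  Nrs)
    (∣m∣n⇒∣m-n (divides c (trans (cong₂ N (sym x≡) (sym y≡)) eq))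
      (∣n⇒∣m*n ((+ 2 * r + q * + k + s) * q + (r + q * + k + + 2 * s + q′ * + k) * q′) ∣-refl))

-- The element constructed is α ᾱ′ / k, where α = x + yζ and α′ = r + sζ ≡ α (mod k).
descent-norm : ∀ x y r s q q′ k k′ P .{{_ : ℤ.NonZero k}} →
  x ≡ r + q * k → y ≡ s + q′ * k → N x y ≡ k * P → N r s ≡ k′ * k →
  N (k′ + (q * r + q * s + q′ * s)) (q′ * r - q * s) ≡ k′ * P
descent-norm x y r s q q′ k k′ P x≡ y≡ Nxy Nrs =
  ℤ.*-cancelˡ-≡ k _ _ (ℤ.*-cancelˡ-≡ k _ _ (begin
    k * (k * N γ₁ γ₂) ≡⟨ scale k γ₁ γ₂ ⟩
    N (k * γ₁) (k * γ₂) ≡⟨ cong₂ N kγ₁ kγ₂ ⟩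
    N (x * (r + s) + y * s) (y * r - x * s) ≡⟨ multiplicative x y r s ⟩
    N x y * N r s ≡⟨ cong₂ _*_ Nxy Nrs ⟩
    (k * P) * (k′ * k) ≡⟨ rearrange k P k′ ⟩
    k * (k * (k′ * P)) ∎))
  where
  open ≡-Reasoning
  γ₁ γ₂ : ℤ
  γ₁ = k′ + (q * r + q * s + q′ * s)
  γ₂ = q′ * r - q * s
  distrib : ∀ k k′ c → k * (k′ + c) ≡ k′ * k + k * c
  distrib = solve-∀
  expand₁ : ∀ r s q q′ k → r * r + r * s + s * s + k * (q * r + q * s + q′ * s)
          ≡ (r + q * k) * (r + s) + (s + q′ * k) * s
  expand₁ = solve-∀
  expand₂ : ∀ r s q q′ k → k * (q′ * r - q * s) ≡ (s + q′ * k) * r - (r + q * k) * s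
  expand₂ = solve-∀
  kγ₁ : k * γ₁ ≡ x * (r + s) + y * s
  kγ₁ = begin
    k * γ₁ ≡⟨ distrib k k′ _ ⟩
    k′ * k + k * (q * r + q * s + q′ * s) ≡⟨ cong (_+ k * (q * r + q * s + q′ * s)) (sym Nrs) ⟩
    N r s + k * (q * r + q * s + q′ * s) ≡⟨ expand₁ r s q q′ k ⟩
    (r + q * k) * (r + s) + (s + q′ * k) * s ≡⟨ cong₂ (λ x y → x * (r + s) + y * s) (sym x≡) (sym y≡) ⟩
    x * (r + s) + y * s ∎
  kγ₂ : k * γ₂ ≡ y * r - x * s
  kγ₂ = trans (expand₂ r s q q′ k) (cong₂ (λ x y → y * r - x * s) (sym x≡) (sym y≡))
  scale : ∀ k x y → k * (k * (x * x + x * y + y * y)) ≡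
    (k * x) * (k * x) + (k * x) * (k * y) + (k * y) * (k * y)
  scale = solve-∀
  multiplicative : ∀ x y r s →
    (x * (r + s) + y * s) * (x * (r + s) + y * s) + (x * (r + s) + y * s) * (y * r - x * s)
      + (y * r - x * s) * (y * r - x * s)
    ≡ (x * x + x * y + y * y) * (r * r + r * s + s * s)
  multiplicative = solve-∀
  rearrange : ∀ k p k′ → (k * p) * (k′ * k) ≡ k * (k * (k′ * p))
  rearrange = solve-∀

-- The degenerate case of the descent: when both remainders vanish, `k²` divides the norm, and so
-- `k` divides the cofactor `P`.
divisible-norm : ∀ x y q q′ k P .{{_ : ℤ.NonZero k}} →
  x ≡ 0ℤ + q * k → y ≡ 0ℤ + q′ * k → N x y ≡ k * P → P ≡ N q q′ * k
divisible-norm _ _ q q′ k P refl refl Nxy =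
  ℤ.*-cancelˡ-≡ k _ _ (trans (sym Nxy) (hom q q′ k))
  where
  hom : ∀ q q′ k →
    (+ 0 + q * k) * (+ 0 + q * k) + (+ 0 + q * k) * (+ 0 + q′ * k) + (+ 0 + q′ * k) * (+ 0 + q′ * k)
    ≡ k * ((q * q + q * q′ + q′ * q′) * k)
  hom = solve-∀

reduction-quotient-< : ∀ {k x y k′} (ρ : Reduction k x y) → Reduction.m ρ ≡ k′ ℕ.* k → k′ ℕ.< k
reduction-quotient-< {k} {k′ = k′} ρ m≡ =
  ℕ.*-cancelʳ-< k k′ k (subst (ℕ._< k ℕ.* k) m≡ (Reduction.m<k² ρ))

-- The remainders have norm `k′ * k` with `k′ < k`, and `descent-norm` trades `k` for `k′`. If they
-- both vanished, `k` would divide the prime `p`, against `k ≢ 1` and `k < p`.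
descent-step : ∀ {p} → Prime p → ∀ k .{{_ : ℕ.NonZero k}} x y → k ≢ 1 → k ℕ.< p → N x y ≡ + (k ℕ.* p) →
  ∃ λ k′ → ∃₂ λ x′ y′ → k′ ℕ.< k × 0 ℕ.< k′ × N x′ y′ ≡ + (k′ ℕ.* p)
descent-step {p} p-prime k x y k≢1 k<p eq =
  let k′ , m≡ = k∣m
  in k′ , + k′ + (q * r + q * s + q′ * s) , q′ * r - q * s ,
     reduction-quotient-< ρ m≡ , ℕ.n≢0⇒n>0 (λ k′≡0 → m≢0 (trans m≡ (cong (ℕ._* k) k′≡0))) ,
     trans (descent-norm x y r s q q′ (+ k) (+ k′) (+ p) x≡ y≡ eq′ (trans Nrs (trans (cong +_ m≡) (ℤ.pos-* k′ k))))
       (sym (ℤ.pos-* k′ p))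
  where
  ρ : Reduction k x y
  ρ = reduction k x y
  open Reduction ρ
  eq′ : N x y ≡ + k * + p
  eq′ = trans eq (ℤ.pos-* k p)
  k∣m : ∃ λ k′ → m ≡ k′ ℕ.* k
  k∣m = reduction-∣ ρ (divides (+ p) (trans eq′ (ℤ.*-comm (+ k) (+ p))))
  m≢0 : m ≢ 0
  m≢0 m≡0 with m≡0⇒r,s≡0 m≡0
  ... | r≡0 , s≡0 with prime⇒irreducible p-prime (∣⇒∣ᵤ {+ k} {+ p} (divides (N q q′)
          (divisible-norm x y q q′ (+ k) (+ p) (trans x≡ (cong (_+ q * + k) r≡0)) (trans y≡ (cong (_+ q′ * + k) s≡0)) eq′)))
  ... | inj₁ k≡1 = k≢1 k≡1
  ... | inj₂ k≡p = ℕ.<-irrefl k≡p k<p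

descent : ∀ {p} → Prime p → ∀ k x y → 0 ℕ.< k → k ℕ.< p → N x y ≡ + (k ℕ.* p) →
          ∃₂ λ a b → N a b ≡ + p
descent {p} p-prime = <-rec _ step
  where
  step : ∀ k → (∀ {k′} → k′ ℕ.< k → ∀ x y → 0 ℕ.< k′ → k′ ℕ.< p → N x y ≡ + (k′ ℕ.* p) →
                ∃₂ λ a b → N a b ≡ + p) →
         ∀ x y → 0 ℕ.< k → k ℕ.< p → N x y ≡ + (k ℕ.* p) → ∃₂ λ a b → N a b ≡ + p
  step k rec x y 0<k k<p eq with k ℕ.≟ 1
  ... | yes refl = x , y , trans eq (cong +_ (ℕ.*-identityˡ p))
  ... | no k≢1 =
    let k′ , x′ , y′ , k′<k , 0<k′ , eq′ = descent-step p-prime k {{ℕ.>-nonZero 0<k}} x y k≢1 k<p eq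
    in rec k′<k x′ y′ 0<k′ (ℕ.<-trans k′<k k<p) eq′

-- Reduction modulo `p` itself supplies the first multiple `k * p` with `k < p`. It is nonzero
-- because `p` does not divide both coordinates.
prime-norm : ∀ {p} → Prime p → ∀ x y → + p ∣ N x y → ¬ (+ p ∣ x × + p ∣ y) → ∃₂ λ a b → N a b ≡ + p
prime-norm {p} p-prime x y p∣N ¬p∣ =
  let k , m≡ = reduction-∣ ρ p∣N
  in descent p-prime k r s (ℕ.n≢0⇒n>0 (λ k≡0 → m≢0 (trans m≡ (cong (ℕ._* p) k≡0)))) (reduction-quotient-< ρ m≡)
       (trans Nrs (cong +_ m≡))
  where
  instance
    p-nonZero : ℕ.NonZero p
    p-nonZero = prime⇒nonZero p-prime
  ρ : Reduction p x y
  ρ = reduction p x y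
  open Reduction ρ
  m≢0 : m ≢ 0
  m≢0 m≡0 = let r≡0 , s≡0 = m≡0⇒r,s≡0 m≡0 in
    ¬p∣ (divides q (trans x≡ (trans (cong (_+ q * + p) r≡0) (ℤ.+-identityˡ _)))
       , divides q′ (trans y≡ (trans (cong (_+ q′ * + p) s≡0) (ℤ.+-identityˡ _))))

-- Primes congruent to 1 modulo 3 are norms.

prime-∣* : ∀ {p} → Prime p → ∀ a b → + p ∣ a * b → + p ∣ a ⊎ + p ∣ b
prime-∣* {p} p-prime a b d =
  Sum.map ∣ᵤ⇒∣ ∣ᵤ⇒∣ (euclidsLemma _ _ p-prime (subst (p ℕ.∣_) (ℤ.abs-* a b) (∣⇒∣ᵤ d)))

prime-∣*-cancelˡ : ∀ {p} → Prime p → ∀ a b → ¬ + p ∣ a → + p ∣ a * b → + p ∣ b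
prime-∣*-cancelˡ p-prime a b p∤a = [ ⊥-elim ∘ p∤a , id ] ∘ prime-∣* p-prime a b

prime-∣² : ∀ {p} → Prime p → ∀ a → + p ∣ a * a → + p ∣ a
prime-∣² p-prime a = [ id , id ] ∘ prime-∣* p-prime a a

∣-pos⇒∣ : ∀ {k n} → + k ∣ + n → k ℕ.∣ n
∣-pos⇒∣ = ∣⇒∣ᵤ

∣-small : ∀ {p c} → + p ∣ + c → c ℕ.< p → c ≡ 0
∣-small {p} {zero} d c<p = refl
∣-small {p} {suc c} d c<p = ⊥-elim (ℕ.<⇒≱ c<p (ℕ.∣⇒≤ (∣-pos⇒∣ d)))

∣-difference : ∀ {p} a b → a ℕ.< p → b ℕ.< p → + p ∣ + a - + b → a ≡ b
∣-difference {p} a b a<p b<p d = ℤ.+-injective (ℤ.i-j≡0⇒i≡j (+ a) (+ b) (ℤ.∣i∣≡0⇒i≡0 (∣-small (∣ᵤ⇒∣ (∣⇒∣ᵤ d)) bound)))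
  where
  bound : ℤ.∣ + a - + b ∣ ℕ.< p
  bound = subst (ℕ._< p) (cong ℤ.∣_∣ (sym (ℤ.m-n≡m⊖n a b))) (ℕ.≤-<-trans (ℤ.∣m⊝n∣≤m⊔n a b) (ℕ.⊔-lub a<p b<p))

-- Vanishes mod p iff X = a + 1 is sent to b + 1 by X ↦ 1/(1 - X); fixed points are roots of X² - X + 1.
image-eq : ℤ → ℤ → ℤ
image-eq a b = (b + + 1) * a + + 1

-- The first two relations make `a` an image of `d` (`da`), and `e` is another one. Subtracting
-- gives `d * (e - a)`, from which `d` cancels modulo `p`.
image-eq³ : ∀ {p} → Prime p → ∀ a b d e → ¬ + p ∣ b → ¬ + p ∣ d →
  + p ∣ image-eq a b → + p ∣ image-eq b d → + p ∣ image-eq d e → + p ∣ e - a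
image-eq³ {p} p-prime a b d e p∤b p∤d ab bd de =
  prime-∣*-cancelˡ p-prime d (e - a) p∤d (subst (+ p ∣_) (identity₂ a d e) (∣m∣n⇒∣m-n de da))
  where
  identity₁ : ∀ a b d → a * ((d + + 1) * b + + 1) - ((b + + 1) * a + + 1) + ((d + + 1) * b + + 1)
            ≡ b * ((a + + 1) * d + + 1)
  identity₁ = solve-∀
  da : + p ∣ image-eq d a
  da = prime-∣*-cancelˡ p-prime b (image-eq d a) p∤b
    (subst (+ p ∣_) (identity₁ a b d) (∣m∣n⇒∣m+n (∣m∣n⇒∣m-n (∣n⇒∣m*n a bd) ab) bd))
  identity₂ : ∀ a d e → (e + + 1) * d + + 1 - ((a + + 1) * d + + 1) ≡ d * (e - a)
  identity₂ = solve-∀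

-- The index i stands for X = i + 2 ∈ 𝔽ₚ ∖ {0,1}, so that C i = X - 1.
module _ (K : ℕ) (p-prime : Prime (2 ℕ.+ K)) where
  private
    p : ℕ
    p = 2 ℕ.+ K
    C : Fin K → ℤ
    C i = + suc (toℕ i)

    neg-inverse : ∀ c .{{_ : ℕ.NonZero c}} → c ℕ.< p → ∃ λ z → + p ∣ z * + c + + 1
    neg-inverse c c<p with coprime-Bézout (prime⇒coprime p-prime c<p)
    ... | Bézout.+- x y eq = + y , divides (+ x) (begin
      + y * + c + + 1 ≡⟨ ℤ.+-comm (+ y * + c) (+ 1) ⟩
      + 1 + + y * + c ≡⟨ cong (λ w → + 1 + w) (sym (ℤ.pos-* y c)) ⟩
      + (1 ℕ.+ y ℕ.* c) ≡⟨ cong +_ eq ⟩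
      + (x ℕ.* p) ≡⟨ ℤ.pos-* x p ⟩
      + x * + p ∎)
      where open ≡-Reasoning
    ... | Bézout.-+ x y eq = - + y , divides (- + x) (begin
      - + y * + c + + 1 ≡⟨ cong (_+ + 1) (sym (ℤ.neg-distribˡ-* (+ y) (+ c))) ⟩
      - (+ y * + c) + + 1
        ≡⟨ cong (λ z → - z + + 1) (trans (sym (ℤ.pos-* y c)) (trans (cong +_ (sym eq)) (cong (λ w → + 1 + w) (ℤ.pos-* x p)))) ⟩
      - (+ 1 + + x * + p) + + 1 ≡⟨ rearrange (+ x) (+ p) ⟩
      - + x * + p ∎)
      where
      open ≡-Reasoning
      rearrange : ∀ x p → - (+ 1 + x * p) + + 1 ≡ - x * p
      rearrange = solve-∀

    C<p : ∀ i → suc (toℕ i) ℕ.< p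
    C<p i = ℕ.s<s (ℕ.m<n⇒m<1+n (Fin.toℕ<n i))

    p∤C : ∀ i → ¬ + p ∣ C i
    p∤C i d with () ← ∣-small d (C<p i)

    residue : ∀ z c → + p ∣ z * c + + 1 → + p ∣ + (z ℤ.%ℕ p) * c + + 1
    residue z c d = subst (+ p ∣_) (trans (cong (λ w → w * c + + 1 - (z ℤ./ℕ p) * c * + p) (ℤ.a≡a%ℕn+[a/ℕn]*n z p))
                      (rearrange (+ (z ℤ.%ℕ p)) (z ℤ./ℕ p) c (+ p)))
                      (∣m∣n⇒∣m-n d (∣n⇒∣m*n ((z ℤ./ℕ p) * c) ∣-refl))
      where
      rearrange : ∀ r q c p → (r + q * p) * c + + 1 - q * c * p ≡ r * c + + 1
      rearrange = solve-∀

    image : ∀ i → ∃ λ j → + p ∣ image-eq (C i) (C j)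
    image i = let z , d = neg-inverse (suc (toℕ i)) (C<p i) in
      in-range (z ℤ.%ℕ p) (ℤ.n%ℕd<d z p) (residue z (C i) d)
      where
      in-range : ∀ y → y ℕ.< p → + p ∣ + y * C i + + 1 → ∃ λ j → + p ∣ image-eq (C i) (C j)
      -- `y` is the value of 1/(1 - X). The values 0 and 1 would make `p` divide 1 or X = i + 2,
      -- both positive and below `p`; any other value has index `y - 2`.
      in-range 0 _ d with () ← ∣-small {c = 1} d (ℕ.s<s ℕ.z<s)
      in-range 1 _ d with () ← ∣-small {c = suc (suc (toℕ i))}
        (subst (+ p ∣_) (cong +_ (trans (ℕ.+-comm _ 1) (cong (λ w → ℕ.suc (ℕ.suc w)) (ℕ.+-identityʳ (toℕ i))))) d)
        (ℕ.s<s (ℕ.s<s (Fin.toℕ<n i)))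
      in-range (suc (suc y)) (ℕ.s≤s (ℕ.s≤s y<K)) d =
        Fin.fromℕ< y<K , subst (λ w → + p ∣ w * C i + + 1)
          (cong +_ (trans (ℕ.+-comm 1 (suc y)) (cong (λ w → suc w ℕ.+ 1) (sym (Fin.toℕ-fromℕ< y<K))))) d

    σ : Fin K → Fin K
    σ i = proj₁ (image i)

    σ³ : ∀ i → σ (σ (σ i)) ≡ i
    σ³ i = Fin.toℕ-injective (ℕ.suc-injective (∣-difference _ _ (C<p (σ (σ (σ i)))) (C<p i)
      (image-eq³ p-prime (C i) (C (σ i)) (C (σ (σ i))) (C (σ (σ (σ i))))
        (p∤C (σ i)) (p∤C (σ (σ i))) (proj₂ (image i)) (proj₂ (image (σ i))) (proj₂ (image (σ (σ i)))))))

    -- At a fixed point the defining relation reads `p ∣ N (C i) 1`, while `p` does not divide the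
    -- coordinate 1; so `prime-norm` applies.
    fixed⇒norm : (∃ λ i → σ i ≡ i) → ∃₂ λ a b → N a b ≡ + p
    fixed⇒norm (i , fixed) = prime-norm p-prime (C i) (+ 1)
      (subst (+ p ∣_) (identity (C i)) (subst (λ j → + p ∣ image-eq (C i) (C j)) fixed (proj₂ (image i))))
      (λ { (_ , p∣1) → ℕ.1+n≢0 (∣-small p∣1 (ℕ.s<s ℕ.z<s)) })
      where
      identity : ∀ a → (a + + 1) * a + + 1 ≡ a * a + a * + 1 + + 1 * + 1
      identity = solve-∀

  -- Without a fixed point the `K = p - 2` elements would fall into orbits of size 3, but `p - 2` is
  -- 2 modulo 3.
  1mod3⇒norm : (2 ℕ.+ K) ℕ.% 3 ≡ 1 → ∃₂ λ a b → N a b ≡ + (2 ℕ.+ K)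
  1mod3⇒norm p%3 = [ fixed⇒norm , (λ (k , K≡) → ⊥-elim (¬3∣K k K≡)) ] (order-3-fixed-point σ σ³)
    where
    ¬3∣K : ∀ k → K ≢ 3 ℕ.* k
    ¬3∣K k K≡ with () ← trans (sym p%3) (trans (cong (λ m → (2 ℕ.+ m) ℕ.% 3)
      (trans K≡ (ℕ.*-comm 3 k))) (ℕ.[m+kn]%n≡m%n 2 k 3))

split-prime-norm : ∀ {p} → Prime p → p ℕ.% 3 ≡ 1 → ∃₂ λ a b → N a b ≡ + p
split-prime-norm {zero} p-prime _ = ⊥-elim (¬prime[0] p-prime)
split-prime-norm {suc zero} p-prime _ = ⊥-elim (¬prime[1] p-prime)
split-prime-norm {suc (suc K)} p-prime = 1mod3⇒norm K p-prime

prime[3] : Prime 3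
prime[3] = from-yes (prime? 3)

-- Arithmetic of ℤ[ζ] and divisibility by an element of prime norm.

infixl 7 _⊗_
-- The product of `a + bζ` and `x + yζ`, computed with `ζ² = ζ - 1`.
_⊗_ : ℤ × ℤ → ℤ × ℤ → ℤ × ℤ
(a , b) ⊗ (x , y) = a * x - b * y , a * y + b * x + b * y

norm : ℤ × ℤ → ℤ
norm (x , y) = N x y

-- Conjugation sends `ζ` to `1 - ζ`.
conj : ℤ × ℤ → ℤ × ℤ
conj (a , b) = a + b , - b

norm-⊗ : ∀ u v → norm (u ⊗ v) ≡ norm u * norm v
norm-⊗ (a , b) (x , y) = identity a b x y
  where
  identity : ∀ a b x y →
    (a * x - b * y) * (a * x - b * y) + (a * x - b * y) * (a * y + b * x + b * y)
      + (a * y + b * x + b * y) * (a * y + b * x + b * y)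
    ≡ (a * a + a * b + b * b) * (x * x + x * y + y * y)
  identity = solve-∀

norm-conj : ∀ u → norm (conj u) ≡ norm u
norm-conj (a , b) = identity a b
  where
  identity : ∀ a b → (a + b) * (a + b) + (a + b) * - b + - b * - b ≡ a * a + a * b + b * b
  identity = solve-∀

conj-⊗-⊗ : ∀ u v → conj u ⊗ (u ⊗ v) ≡ (norm u * proj₁ v , norm u * proj₂ v)
conj-⊗-⊗ (a , b) (x , y) = cong₂ _,_ (identity₁ a b x y) (identity₂ a b x y)
  where
  identity₁ : ∀ a b x y → (a + b) * (a * x - b * y) - - b * (a * y + b * x + b * y)
    ≡ (a * a + a * b + b * b) * x
  identity₁ = solve-∀
  identity₂ : ∀ a b x y → (a + b) * (a * y + b * x + b * y) + - b * (a * x - b * y) + - b * (a * y + b * x + b * y)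
    ≡ (a * a + a * b + b * b) * y
  identity₂ = solve-∀

⊗-cancelˡ : ∀ u v w → ℤ.NonZero (norm u) → u ⊗ v ≡ u ⊗ w → v ≡ w
⊗-cancelˡ u v@(x , y) w@(x′ , y′) nz eq =
  cong₂ _,_ (ℤ.*-cancelˡ-≡ (norm u) x x′ {{nz}} (cong proj₁ scaled))
            (ℤ.*-cancelˡ-≡ (norm u) y y′ {{nz}} (cong proj₂ scaled))
  where
  scaled : (norm u * x , norm u * y) ≡ (norm u * x′ , norm u * y′)
  scaled = trans (sym (conj-⊗-⊗ u v)) (trans (cong (conj u ⊗_) eq) (conj-⊗-⊗ u w))

-- For π = a + bζ of prime norm p, φ π is a multiple of the reduction ℤ[ζ] → ℤ[ζ]/π ≅ 𝔽ₚ.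
φ : ℤ × ℤ → ℤ × ℤ → ℤ
φ (a , b) (x , y) = a * y - b * x

-- Modulo `π` the conjugate of `π` equals the trace `2a + b`. Hence multiplication by it only
-- rescales `φ π` modulo `norm π`.
φ-conj-⊗ : ∀ π u → φ π (conj π ⊗ u) ≡ (+ 2 * proj₁ π + proj₂ π) * φ π u - norm π * proj₂ u
φ-conj-⊗ (a , b) (x , y) = identity a b x y
  where
  identity : ∀ a b x y → a * ((a + b) * y + - b * x + - b * y) - b * ((a + b) * x - - b * y)
    ≡ (+ 2 * a + b) * (a * y - b * x) - (a * a + a * b + b * b) * y
  identity = solve-∀

φ-*-φ-conj : ∀ π u → φ π u * φ (conj π) u ≡ norm π * (proj₂ u * proj₂ u) - norm u * (proj₂ π * proj₂ π)
φ-*-φ-conj (a , b) (x , y) = identity a b x y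
  where
  identity : ∀ a b x y → (a * y - b * x) * ((a + b) * y - - b * x)
    ≡ (a * a + a * b + b * b) * (y * y) - (x * x + x * y + y * y) * (b * b)
  identity = solve-∀

module _ {p : ℕ} (p-prime : Prime p) (π : ℤ × ℤ) (Nπ : norm π ≡ + p) where
  private
    a b : ℤ
    a = proj₁ π
    b = proj₂ π
    instance
      p-nonZero : ℕ.NonZero p
      p-nonZero = prime⇒nonZero p-prime

    p∣Nπ : + p ∣ norm π
    p∣Nπ = subst (+ p ∣_) (sym Nπ) ∣-refl

  -- The quotient is `conj π ⊗ u` divided by `p`. Its numerator has coordinates `r` and `s`, where
  -- `s` is `φ π u`; since `N r s` is `norm π * norm u`, divisibility of `s` by `p` forces that of
  -- `r²`.
  φ-∣⇒divisible : ∀ u → + p ∣ φ π u → ∃ λ v → u ≡ π ⊗ v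
  φ-∣⇒divisible (x , y) p∣s@(divides s′ s≡) = quotient (prime-∣² p-prime r p∣r²)
    where
    r s : ℤ
    r = (a + b) * x + b * y
    s = a * y - b * x
    r² : ∀ a b x y → (a * a + a * b + b * b) * (x * x + x * y + y * y)
           - (a * y - b * x) * ((a + b) * x + b * y + (a * y - b * x))
         ≡ ((a + b) * x + b * y) * ((a + b) * x + b * y)
    r² = solve-∀
    p∣r² : + p ∣ r * r
    p∣r² = subst (+ p ∣_) (r² a b x y)
      (∣m∣n⇒∣m-n (∣m⇒∣m*n (N x y) p∣Nπ) (∣m⇒∣m*n (r + s) p∣s))
    px : ∀ a b x y → a * ((a + b) * x + b * y) - b * (a * y - b * x) ≡ (a * a + a * b + b * b) * x
    px = solve-∀
    py : ∀ a b x y → a * (a * y - b * x) + b * ((a + b) * x + b * y) + b * (a * y - b * x) ≡ (a * a + a * b + b * b) * y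
    py = solve-∀
    pull₁ : ∀ a b r s p → a * (r * p) - b * (s * p) ≡ p * (a * r - b * s)
    pull₁ = solve-∀
    pull₂ : ∀ a b r s p → a * (s * p) + b * (r * p) + b * (s * p) ≡ p * (a * s + b * r + b * s)
    pull₂ = solve-∀
    quotient : + p ∣ r → ∃ λ v → (x , y) ≡ π ⊗ v
    quotient (divides r′ r≡) = (r′ , s′) , cong₂ _,_
      (ℤ.*-cancelˡ-≡ (+ p) x _ (trans (cong (_* x) (sym Nπ)) (trans (sym (px a b x y))
        (trans (cong₂ (λ r s → a * r - b * s) r≡ s≡) (pull₁ a b r′ s′ (+ p))))))
      (ℤ.*-cancelˡ-≡ (+ p) y _ (trans (cong (_* y) (sym Nπ)) (trans (sym (py a b x y))
        (trans (cong₂ (λ r s → a * s + b * r + b * s) r≡ s≡) (pull₂ a b r′ s′ (+ p))))))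

  split-∣ : ∀ u → + p ∣ norm u → + p ∣ φ π u ⊎ + p ∣ φ (conj π) u
  split-∣ u p∣u = prime-∣* p-prime (φ π u) (φ (conj π) u) (subst (+ p ∣_) (sym (φ-*-φ-conj π u))
    (∣m∣n⇒∣m-n (∣m⇒∣m*n (proj₂ u * proj₂ u) p∣Nπ) (∣m⇒∣m*n (b * b) p∣u)))

  ∣φ⇒∣norm : ∀ u → + p ∣ φ π u → + p ∣ norm u
  ∣φ⇒∣norm u p∣φ = let v , eq = φ-∣⇒divisible u p∣φ in
    subst (+ p ∣_) (trans (sym (norm-⊗ π v)) (cong norm (sym eq))) (∣m⇒∣m*n (norm v) p∣Nπ)

  ∣φ-conj-⊗⁺ : ∀ u → + p ∣ φ π u → + p ∣ φ π (conj π ⊗ u)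
  ∣φ-conj-⊗⁺ u d = subst (+ p ∣_) (sym (φ-conj-⊗ π u))
    (∣m∣n⇒∣m-n (∣n⇒∣m*n (+ 2 * a + b) d) (∣m⇒∣m*n (proj₂ u) p∣Nπ))

  -- If `p` divided `b`, it would divide `a` as well, and `p²` would divide `norm π`, which is `p`.
  p∤b : ¬ + p ∣ b
  p∤b p∣b@(divides b′ b≡) = ¬p∣a (prime-∣² p-prime a
    (subst (+ p ∣_) (identity a b) (∣m∣n⇒∣m-n p∣Nπ (∣n⇒∣m*n (a + b) p∣b))))
    where
    identity : ∀ a b → a * a + a * b + b * b - (a + b) * b ≡ a * a
    identity = solve-∀
    scale : ∀ a b p → (a * p) * (a * p) + (a * p) * (b * p) + (b * p) * (b * p) ≡ p * ((a * a + a * b + b * b) * p)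
    scale = solve-∀
    ¬p∣a : ¬ + p ∣ a
    ¬p∣a (divides a′ a≡) = ¬prime[1] (subst Prime (ℕ.∣1⇒≡1 (∣-pos⇒∣ {p} {1} (divides (N a′ b′) 1≡))) p-prime)
      where
      1≡ : + 1 ≡ N a′ b′ * + p
      1≡ = ℤ.*-cancelˡ-≡ (+ p) 1ℤ (N a′ b′ * + p)
        (trans (ℤ.*-identityʳ (+ p)) (trans (sym Nπ) (trans (cong₂ N a≡ b≡) (scale a′ b′ (+ p)))))

  module _ (p≢3 : p ≢ 3) where
    p∤3 : ¬ + p ∣ + 3
    p∤3 p∣3 with prime⇒irreducible prime[3] (∣-pos⇒∣ p∣3)
    ... | inj₁ p≡1 = ¬prime[1] (subst Prime p≡1 p-prime)
    ... | inj₂ p≡3 = p≢3 p≡3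

    -- By `4N = (2a + b)² + 3b²`, a prime dividing the norm and the trace divides `3b²`. This is
    -- where the ramified prime 3 is set apart.
    p∤2a+b : ¬ + p ∣ + 2 * a + b
    p∤2a+b d = p∤b (prime-∣² p-prime b (prime-∣*-cancelˡ p-prime (+ 3) (b * b) p∤3
      (subst (+ p ∣_) (identity a b) (∣m∣n⇒∣m-n (∣n⇒∣m*n (+ 4) p∣Nπ) (∣m⇒∣m*n (+ 2 * a + b) d)))))
      where
      identity : ∀ a b → + 4 * (a * a + a * b + b * b) - (+ 2 * a + b) * (+ 2 * a + b) ≡ + 3 * (b * b)
      identity = solve-∀

    ∣φ-conj-⊗⁻ : ∀ u → + p ∣ φ π (conj π ⊗ u) → + p ∣ φ π u
    ∣φ-conj-⊗⁻ u d = prime-∣*-cancelˡ p-prime (+ 2 * a + b) (φ π u) p∤2a+b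
      (subst (+ p ∣_) (trans (cong (_+ c) (φ-conj-⊗ π u)) (cancel ((+ 2 * a + b) * φ π u) c))
        (∣m∣n⇒∣m+n d (∣m⇒∣m*n (proj₂ u) p∣Nπ)))
      where
      c : ℤ
      c = norm π * proj₂ u
      cancel : ∀ x c → x - c + c ≡ x
      cancel = solve-∀

-- Elements of given norm: the ramified prime 3 and the split primes.

R : ℕ → Set
R m = Σ (ℤ × ℤ) λ u → norm u ≡ + m

R-≡ : ∀ {m} {u v : R m} → proj₁ u ≡ proj₁ v → u ≡ v
R-≡ {u = u , p} {.u , q} refl = cong (u ,_) (≡-irrelevant p q)

scaleR : ∀ {c m} π → norm π ≡ + c → R m → R (c ℕ.* m)
scaleR {c} {m} π Nπ (u , Nu) = π ⊗ u , trans (norm-⊗ π u) (trans (cong₂ _*_ Nπ Nu) (sym (ℤ.pos-* c m)))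

norm-quotient : ∀ {c m} .{{_ : ℕ.NonZero c}} {π u v} → norm π ≡ + c → norm u ≡ + (c ℕ.* m) → u ≡ π ⊗ v → norm v ≡ + m
norm-quotient {c} {m} {π} {u} {v} Nπ Nu refl = ℤ.*-cancelˡ-≡ (+ c) (norm v) (+ m)
  (trans (cong (_* norm v) (sym Nπ)) (trans (sym (norm-⊗ π v)) (trans Nu (ℤ.pos-* c m))))

cancelR : ∀ {c} .{{_ : ℕ.NonZero c}} {π u v} → norm π ≡ + c → π ⊗ u ≡ π ⊗ v → u ≡ v
cancelR {c} {{nz}} {π} {u} {v} Nπ = ⊗-cancelˡ π u v (subst ℤ.NonZero (sym Nπ) (recompute-nz nz))
  where
  recompute-nz : ∀ {c} → .(ℕ.NonZero c) → ℤ.NonZero (+ c)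
  recompute-nz {suc c} _ = _

scaleR-↔ : ∀ {c m} .{{_ : ℕ.NonZero c}} π (Nπ : norm π ≡ + c) →
  (∀ u → norm u ≡ + (c ℕ.* m) → ∃ λ v → u ≡ π ⊗ v) → R m ↔ R (c ℕ.* m)
scaleR-↔ {c} {m} π Nπ quotient = bijective⇒↔ (scaleR π Nπ)
  (λ {u} {v} eq → R-≡ (cancelR {c} {π} {proj₁ u} {proj₁ v} Nπ (cong proj₁ eq)))
  (λ { (u , Nu) → let v , eq = quotient u Nu in (v , norm-quotient {c} {m} {π} Nπ Nu eq) , R-≡ (sym eq) })

*-∣ : ∀ {c m} {z} → z ≡ + (c ℕ.* m) → + c ∣ z
*-∣ {c} {m} z≡ = divides (+ m) (trans z≡ (trans (ℤ.pos-* c m) (ℤ.*-comm (+ c) (+ m))))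

-- The element `1 + ζ` of norm 3 is associate to its conjugate, so both alternatives of `split-∣`
-- amount to divisibility by `1 + ζ`.
ramified-↔ : ∀ m → R m ↔ R (3 ℕ.* m)
ramified-↔ m = scaleR-↔ (1ℤ , 1ℤ) refl λ u Nu → φ-∣⇒divisible prime[3] (1ℤ , 1ℤ) refl u
  ([ id , conj⇒ u ] (split-∣ prime[3] (1ℤ , 1ℤ) refl u (*-∣ {3} {m} Nu)))
  where
  conj⇒ : ∀ u → + 3 ∣ φ (conj (1ℤ , 1ℤ)) u → + 3 ∣ φ (1ℤ , 1ℤ) u
  conj⇒ (x , y) d = subst (+ 3 ∣_) (identity x y) (∣m∣n⇒∣m-n (∣m⇒∣m*n y ∣-refl) d)
    where
    identity : ∀ x y → + 3 * y - ((+ 1 + + 1) * y - - + 1 * x) ≡ + 1 * y - + 1 * x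
    identity = solve-∀

-- This is `p^v * m`, arranged so that raising the exponent by one unfolds to a multiplication by
-- `p`.
times-pow : ℕ → ℕ → ℕ → ℕ
times-pow p zero m = m
times-pow p (suc v) m = p ℕ.* times-pow p v m

ramified-pow-↔ : ∀ v m → R m ↔ R (times-pow 3 v m)
ramified-pow-↔ zero m = ↔-id _
ramified-pow-↔ (suc v) m = ramified-↔ _ ↔-∘ ramified-pow-↔ v m

module _ {p : ℕ} (p-prime : Prime p) (π : ℤ × ℤ) (Nπ : norm π ≡ + p) (p≢3 : p ≢ 3)
         {m : ℕ} (p∤m : ¬ p ℕ.∣ m) where
  private
    instance
      p-nonZero : ℕ.NonZero p
      p-nonZero = prime⇒nonZero p-prime

    π̄ : ℤ × ℤ
    π̄ = conj π

    Nπ̄ : norm π̄ ≡ + p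
    Nπ̄ = trans (norm-conj π) Nπ

    scale-π̄^ : ∀ k → R m → R (times-pow p k m)
    scale-π̄^ zero u = u
    scale-π̄^ (suc k) u = scaleR π̄ Nπ̄ (scale-π̄^ k u)

    scale-π̄^-injective : ∀ k {u v} → proj₁ (scale-π̄^ k u) ≡ proj₁ (scale-π̄^ k v) → u ≡ v
    scale-π̄^-injective zero eq = R-≡ eq
    scale-π̄^-injective (suc k) {u} {v} eq = scale-π̄^-injective k
      (cancelR {p} {π̄} {proj₁ (scale-π̄^ k u)} {proj₁ (scale-π̄^ k v)} Nπ̄ eq)

    p∤φ-scale-π̄^ : ∀ k u → ¬ + p ∣ φ π (proj₁ (scale-π̄^ k u))
    p∤φ-scale-π̄^ zero (u , Nu) d = p∤m (∣-pos⇒∣ (subst (+ p ∣_) Nu (∣φ⇒∣norm p-prime π Nπ u d)))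
    p∤φ-scale-π̄^ (suc k) u d = p∤φ-scale-π̄^ k u (∣φ-conj-⊗⁻ p-prime π Nπ p≢3 (proj₁ (scale-π̄^ k u)) d)

    -- An element not divisible by `π` must take each of its `k` factors over `p` from `π̄`:
    -- `split-∣` yields one of them, and the quotient is again not divisible by `π`.
    quotient-π̄^ : ∀ k (u : R (times-pow p k m)) → ¬ + p ∣ φ π (proj₁ u) → ∃ λ v → scale-π̄^ k v ≡ u
    quotient-π̄^ zero u _ = u , refl
    quotient-π̄^ (suc k) (u , Nu) p∤φ = step
      ([ ⊥-elim ∘ p∤φ , φ-∣⇒divisible p-prime π̄ Nπ̄ u ] (split-∣ p-prime π Nπ u (*-∣ {p} {times-pow p k m} Nu)))
      where
      step : (∃ λ v → u ≡ π̄ ⊗ v) → ∃ λ v → scale-π̄^ (suc k) v ≡ (u , Nu)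
      step (v , eq) =
        let w , eq′ = quotient-π̄^ k (v , norm-quotient {p} {times-pow p k m} {π̄} {u} {v} Nπ̄ Nu eq)
                        (λ d → p∤φ (subst (λ u → + p ∣ φ π u) (sym eq) (∣φ-conj-⊗⁺ p-prime π Nπ v d)))
        in w , R-≡ (trans (cong (λ z → π̄ ⊗ proj₁ z) eq′) (sym eq))

  -- Elements of norm p^(v+1)m are those divisible by π and those of the form π̄^(v+1) times a norm m element.
  split-↔ : ∀ v → (R m ⊎ R (times-pow p v m)) ↔ R (times-pow p (suc v) m)
  split-↔ v = bijective⇒↔ f (f-injective _ _) f-surjective
    where
    f : R m ⊎ R (times-pow p v m) → R (times-pow p (suc v) m)
    f (inj₁ u) = scale-π̄^ (suc v) u
    f (inj₂ u) = scaleR π Nπ u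
    p∣φ-π⊗ : ∀ u → + p ∣ φ π (π ⊗ u)
    p∣φ-π⊗ (x , y) = subst (+ p ∣_) (identity (proj₁ π) (proj₂ π) x y)
      (∣m⇒∣m*n y (subst (+ p ∣_) (sym Nπ) ∣-refl))
      where
      identity : ∀ a b x y → (a * a + a * b + b * b) * y ≡ a * (a * y + b * x + b * y) - b * (a * x - b * y)
      identity = solve-∀
    f-injective : ∀ u v → f u ≡ f v → u ≡ v
    f-injective (inj₁ u) (inj₁ w) eq = cong inj₁ (scale-π̄^-injective (suc v) (cong proj₁ eq))
    f-injective (inj₁ u) (inj₂ w) eq = ⊥-elim (p∤φ-scale-π̄^ (suc v) u
      (subst (λ z → + p ∣ φ π (proj₁ z)) (sym eq) (p∣φ-π⊗ (proj₁ w))))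
    f-injective (inj₂ u) (inj₁ w) eq = ⊥-elim (p∤φ-scale-π̄^ (suc v) w
      (subst (λ z → + p ∣ φ π (proj₁ z)) eq (p∣φ-π⊗ (proj₁ u))))
    f-injective (inj₂ u) (inj₂ w) eq =
      cong inj₂ (R-≡ (cancelR {p} {π} {proj₁ u} {proj₁ w} Nπ (cong proj₁ eq)))
    f-surjective : ∀ u → ∃ λ z → f z ≡ u
    f-surjective (u , Nu) with + p ∣? φ π u
    ... | yes d = let w , eq = φ-∣⇒divisible p-prime π Nπ u d in
      inj₂ (w , norm-quotient {p} {times-pow p v m} {π} {u} {w} Nπ Nu eq) , R-≡ (sym eq)
    ... | no ¬d = let w , eq = quotient-π̄^ (suc v) (u , Nu) ¬d in inj₁ w , eq

  -- The `suc v` blocks correspond to the products of `i` factors `π` and `v - i` factors `π̄`.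
  split-pow-↔ : ∀ v {k} → R m ↔ Fin k → R (times-pow p v m) ↔ Fin (suc v ℕ.* k)
  split-pow-↔ zero {k} e rewrite ℕ.+-identityʳ k = e
  split-pow-↔ (suc v) e = ↔-sym Fin.+↔⊎ ↔-∘ ((e ⊎-↔ split-pow-↔ v e) ↔-∘ ↔-sym (split-↔ v))

-- Norms modulo an integer and the inert primes.

≡-mod : ∀ d .{{_ : ℕ.NonZero d}} m n c → + m ≡ + n - c * + d → m ℕ.% d ≡ n ℕ.% d
≡-mod d m n (+ k) eq = trans (sym (ℕ.[m+kn]%n≡m%n m k d)) (cong (ℕ._% d) (ℤ.+-injective (begin
  + (m ℕ.+ k ℕ.* d) ≡⟨ cong (λ w → + m + w) (ℤ.pos-* k d) ⟩
  + m + + k * + d ≡⟨ cong (_+ + k * + d) eq ⟩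
  + n - + k * + d + + k * + d ≡⟨ cancel (+ n) (+ k * + d) ⟩
  + n ∎)))
  where
  open ≡-Reasoning
  cancel : ∀ n c → n - c + c ≡ n
  cancel = solve-∀
≡-mod d m n ℤ.-[1+ k ] eq = trans (cong (ℕ._% d) (ℤ.+-injective (begin
  + m ≡⟨ eq ⟩
  + n - - + suc k * + d ≡⟨ cancel (+ n) (+ suc k) (+ d) ⟩
  + n + + suc k * + d ≡⟨ cong (λ w → + n + w) (sym (ℤ.pos-* (suc k) d)) ⟩
  + (n ℕ.+ suc k ℕ.* d) ∎))) (ℕ.[m+kn]%n≡m%n n (suc k) d)
  where
  open ≡-Reasoning
  cancel : ∀ n k d → n - - k * d ≡ n + k * d
  cancel = solve-∀

norm-mod : ∀ d .{{_ : ℕ.NonZero d}} x y n → N x y ≡ + n →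
  Nℕ (x ℤ.%ℕ d) (y ℤ.%ℕ d) ℕ.% d ≡ n ℕ.% d
norm-mod d x y n eq = ≡-mod d _ n c (begin
  + Nℕ (x ℤ.%ℕ d) (y ℤ.%ℕ d) ≡⟨ pos-N (x ℤ.%ℕ d) (y ℤ.%ℕ d) ⟩
  N r s ≡⟨ N-reduce r q s q′ (+ d) ⟩
  N (r + q * + d) (s + q′ * + d) - c * + d
    ≡⟨ cong (_- c * + d) (trans (cong₂ N (sym (ℤ.a≡a%ℕn+[a/ℕn]*n x d)) (sym (ℤ.a≡a%ℕn+[a/ℕn]*n y d))) eq) ⟩
  + n - c * + d ∎)
  where
  open ≡-Reasoning
  r q s q′ c : ℤ
  r = + (x ℤ.%ℕ d)
  q = x ℤ./ℕ d
  s = + (y ℤ.%ℕ d)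
  q′ = y ℤ./ℕ d
  c = (+ 2 * r + q * + d + s) * q + (r + q * + d + + 2 * s + q′ * + d) * q′

all-residues : ∀ {d} {P : ℕ → ℕ → Set} → (∀ (i j : Fin d) → P (toℕ i) (toℕ j)) →
  ∀ {r s} → r ℕ.< d → s ℕ.< d → P r s
all-residues {P = P} all r<d s<d =
  subst₂ P (Fin.toℕ-fromℕ< r<d) (Fin.toℕ-fromℕ< s<d) (all (Fin.fromℕ< r<d) (Fin.fromℕ< s<d))

norm≢2mod3 : ∀ x y n → N x y ≡ + n → n ℕ.% 3 ≢ 2
norm≢2mod3 x y n eq n%3≡2 =
  all-residues {3} {λ r s → Nℕ r s ℕ.% 3 ≢ 2}
    (from-yes (Fin.all? {3} λ i → Fin.all? {3} λ j → ¬? (Nℕ (toℕ i) (toℕ j) ℕ.% 3 ℕ.≟ 2)))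
    (ℤ.n%ℕd<d x 3) (ℤ.n%ℕd<d y 3) (trans (norm-mod 3 x y n eq) n%3≡2)

module _ {q : ℕ} (q-prime : Prime q) (q%3≡2 : q ℕ.% 3 ≡ 2) where
  private
    instance
      q-nonZero : ℕ.NonZero q
      q-nonZero = prime⇒nonZero q-prime
      q²-nonZero : ℕ.NonZero (q ℕ.* q)
      q²-nonZero = ℕ.m*n≢0 q q

  -- Otherwise `prime-norm` would make `q` itself a norm, which its residue modulo 3 forbids.
  inert-∣ : ∀ x y → + q ∣ N x y → + q ∣ x × + q ∣ y
  inert-∣ x y d with (+ q ∣? x) ×-dec (+ q ∣? y)
  ... | yes both = both
  ... | no ¬both = let a , b , eq = prime-norm q-prime x y d ¬both in ⊥-elim (norm≢2mod3 a b q eq q%3≡2)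

  inert-divisible : ∀ u → + q ∣ norm u → ∃ λ v → u ≡ (+ q , 0ℤ) ⊗ v
  inert-divisible (x , y) d with inert-∣ x y d
  ... | divides x′ x≡ , divides y′ y≡ = (x′ , y′) ,
    cong₂ _,_ (trans x≡ (identity₁ x′ y′ (+ q))) (trans y≡ (identity₂ x′ y′ (+ q)))
    where
    identity₁ : ∀ x y q → x * q ≡ q * x - + 0 * y
    identity₁ = solve-∀
    identity₂ : ∀ x y q → y * q ≡ q * y + + 0 * x + + 0 * y
    identity₂ = solve-∀

  norm-q : norm (+ q , 0ℤ) ≡ + (q ℕ.* q)
  norm-q = trans (identity (+ q)) (sym (ℤ.pos-* q q))
    where
    identity : ∀ q → q * q + q * + 0 + + 0 * + 0 ≡ q * q
    identity = solve-∀

  inert-square-↔ : ∀ m → R m ↔ R (q ℕ.* (q ℕ.* m))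
  inert-square-↔ m = subst (λ n → R m ↔ R n) (ℕ.*-assoc q q m) (scaleR-↔ (+ q , 0ℤ) norm-q
    λ u Nu → inert-divisible u (*-∣ {q} {q ℕ.* m} (trans Nu (cong +_ (ℕ.*-assoc q q m)))))

  -- A norm divisible by `q` is that of a multiple of `q`, hence divisible by `q²`.
  inert-empty : ∀ {m} → ¬ q ℕ.∣ m → ¬ R (q ℕ.* m)
  inert-empty {m} q∤m (u , Nu) = let v , eq = inert-divisible u (*-∣ {q} {m} Nu) in
    q∤m (∣-pos⇒∣ (divides (norm v) (ℤ.*-cancelˡ-≡ (+ q) (+ m) (norm v * + q) (begin
      + q * + m ≡⟨ sym (ℤ.pos-* q m) ⟩
      + (q ℕ.* m) ≡⟨ sym Nu ⟩
      norm u ≡⟨ cong norm eq ⟩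
      norm ((+ q , 0ℤ) ⊗ v) ≡⟨ norm-⊗ (+ q , 0ℤ) v ⟩
      norm (+ q , 0ℤ) * norm v ≡⟨ cong (_* norm v) (trans norm-q (ℤ.pos-* q q)) ⟩
      + q * + q * norm v ≡⟨ trans (ℤ.*-assoc (+ q) (+ q) (norm v)) (cong (λ w → + q * w) (ℤ.*-comm (+ q) (norm v))) ⟩
      + q * (norm v * + q) ∎))))
    where open ≡-Reasoning

  inert-even-↔ : ∀ v m → isEven v ≡ true → R m ↔ R (times-pow q v m)
  inert-even-↔ zero m _ = ↔-id _
  inert-even-↔ (suc (suc v)) m even = inert-square-↔ _ ↔-∘ inert-even-↔ v m even

  inert-odd-empty : ∀ v {m} → ¬ q ℕ.∣ m → isEven v ≡ false → ¬ R (times-pow q v m)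
  inert-odd-empty 1 q∤m _ = inert-empty q∤m
  inert-odd-empty (suc (suc v)) q∤m odd u =
    inert-odd-empty v q∤m odd (Inverse.from (inert-square-↔ _) u)

-- These are the six units. From `4N = (2x + y)² + 3y²` and its mirror image, norm 1 bounds both
-- coordinates by 1 in absolute value, which leaves finitely many pairs.
R1↔Fin6 : R 1 ↔ Fin 6
R1↔Fin6 = ↔-sym (bijective⇒↔ unit
  (λ {i} {j} eq → trans (sym (index-unit i)) (trans (cong (index ∘ proj₁) eq) (index-unit j))) surj)
  where
  unit : Fin 6 → R 1
  unit zero = (+ 1 , + 0) , refl
  unit (suc zero) = (- + 1 , + 0) , refl
  unit (suc (suc zero)) = (+ 0 , + 1) , refl
  unit (suc (suc (suc zero))) = (+ 0 , - + 1) , refl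
  unit (suc (suc (suc (suc zero)))) = (+ 1 , - + 1) , refl
  unit (suc (suc (suc (suc (suc zero))))) = (- + 1 , + 1) , refl
  index : ℤ × ℤ → Fin 6
  index (+ 1 , + 0) = zero
  index (ℤ.-[1+ 0 ] , + 0) = suc zero
  index (+ 0 , + 1) = suc (suc zero)
  index (+ 0 , ℤ.-[1+ 0 ]) = suc (suc (suc zero))
  index (+ 1 , _) = suc (suc (suc (suc zero)))
  index _ = suc (suc (suc (suc (suc zero))))
  index-unit : ∀ i → index (proj₁ (unit i)) ≡ i
  index-unit zero = refl
  index-unit (suc zero) = refl
  index-unit (suc (suc zero)) = refl
  index-unit (suc (suc (suc zero))) = refl
  index-unit (suc (suc (suc (suc zero)))) = refl
  index-unit (suc (suc (suc (suc (suc zero))))) = refl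
  square : ∀ z → z * z ≡ + (ℤ.∣ z ∣ ℕ.* ℤ.∣ z ∣)
  square (+ n) = sym (ℤ.pos-* n n)
  square ℤ.-[1+ n ] = refl
  bound : ∀ s t → s ℕ.+ 3 ℕ.* (t ℕ.* t) ≡ 4 → t < 2
  bound s t eq = ℕ.≰⇒> λ 2≤t → ℕ.<⇒≱ {4} {12} (ℕ.m≤m+n 5 7)
    (ℕ.≤-trans (ℕ.*-monoʳ-≤ 3 (ℕ.*-mono-≤ 2≤t 2≤t)) (ℕ.≤-trans (ℕ.m≤n+m _ s) (ℕ.≤-reflexive eq)))
  small : ∀ w z → w * w + + 3 * (z * z) ≡ + 4 → ℤ.∣ z ∣ < 2
  small w z eq = bound (ℤ.∣ w ∣ ℕ.* ℤ.∣ w ∣) ℤ.∣ z ∣ (ℤ.+-injective (trans (sym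
    (cong₂ _+_ (square w) (trans (cong (λ z → + 3 * z) (square z)) (sym (ℤ.pos-* 3 (ℤ.∣ z ∣ ℕ.* ℤ.∣ z ∣)))))) eq))
  4N : ∀ x y → (+ 2 * x + y) * (+ 2 * x + y) + + 3 * (y * y) ≡ + 4 * (x * x + x * y + y * y)
  4N = solve-∀
  4N′ : ∀ x y → (+ 2 * y + x) * (+ 2 * y + x) + + 3 * (x * x) ≡ + 4 * (x * x + x * y + y * y)
  4N′ = solve-∀
  cases : ∀ x y → ℤ.∣ x ∣ < 2 → ℤ.∣ y ∣ < 2 → (eq : N x y ≡ + 1) → ∃ λ i → proj₁ (unit i) ≡ (x , y)
  cases (+ 1) (+ 0) _ _ _ = zero , refl
  cases ℤ.-[1+ 0 ] (+ 0) _ _ _ = suc zero , refl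
  cases (+ 0) (+ 1) _ _ _ = suc (suc zero) , refl
  cases (+ 0) ℤ.-[1+ 0 ] _ _ _ = suc (suc (suc zero)) , refl
  cases (+ 1) ℤ.-[1+ 0 ] _ _ _ = suc (suc (suc (suc zero))) , refl
  cases ℤ.-[1+ 0 ] (+ 1) _ _ _ = suc (suc (suc (suc (suc zero)))) , refl
  cases (+ 0) (+ 0) _ _ ()
  cases (+ 1) (+ 1) _ _ ()
  cases ℤ.-[1+ 0 ] ℤ.-[1+ 0 ] _ _ ()
  cases (+ suc (suc _)) _ (ℕ.s≤s (ℕ.s≤s ()))
  cases ℤ.-[1+ suc _ ] _ (ℕ.s≤s (ℕ.s≤s ()))
  cases _ (+ suc (suc _)) _ (ℕ.s≤s (ℕ.s≤s ()))
  cases _ ℤ.-[1+ suc _ ] _ (ℕ.s≤s (ℕ.s≤s ()))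
  surj : ∀ u → ∃ λ i → unit i ≡ u
  surj ((x , y) , eq) =
    let i , eq′ = cases x y (small (+ 2 * y + x) x (trans (4N′ x y) (cong (λ z → + 4 * z) eq)))
                            (small (+ 2 * x + y) y (trans (4N x y) (cong (λ z → + 4 * z) eq))) eq
    in i , R-≡ eq′

-- Multiplicities in lists of primes and removal of a prime.

≡ᵇ-refl : ∀ n → (n ≡ᵇ n) ≡ true
≡ᵇ-refl zero = refl
≡ᵇ-refl (suc n) = ≡ᵇ-refl n

≡ᵇ-true⇒≡ : ∀ m n → (m ≡ᵇ n) ≡ true → m ≡ n
≡ᵇ-true⇒≡ m n eq = ℕ.≡ᵇ⇒≡ m n (subst T (sym eq) _)

≡ᵇ-false⇒≢ : ∀ m n → (m ≡ᵇ n) ≡ false → m ≢ n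
≡ᵇ-false⇒≢ m .m eq refl with () ← trans (sym eq) (≡ᵇ-refl m)

remove : ℕ → List ℕ → List ℕ
remove p [] = []
remove p (q ∷ qs) = if p ≡ᵇ q then remove p qs else q ∷ remove p qs

All-remove : ∀ {P Q : ℕ → Set} p → (∀ {q} → p ≢ q → P q → Q q) → ∀ {ps} → All P ps → All Q (remove p ps)
All-remove p f [] = []
All-remove p f {q ∷ qs} (x ∷ xs) with p ≡ᵇ q in eq
... | true = All-remove p f xs
... | false = f (≡ᵇ-false⇒≢ p q eq) x ∷ All-remove p f xs

mult-remove-≢ : ∀ c p ps → c ≢ p → mult c (remove p ps) ≡ mult c ps
mult-remove-≢ c p [] c≢p = refl
mult-remove-≢ c p (q ∷ qs) c≢p with p ≡ᵇ q in p≡q | c ≡ᵇ q in c≡q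
... | true | true = ⊥-elim (c≢p (trans (≡ᵇ-true⇒≡ c q c≡q) (sym (≡ᵇ-true⇒≡ p q p≡q))))
... | true | false = mult-remove-≢ c p qs c≢p
... | false | true rewrite c≡q = cong suc (mult-remove-≢ c p qs c≢p)
... | false | false rewrite c≡q = mult-remove-≢ c p qs c≢p

mult-≢ : ∀ p {ps} → All (p ≢_) ps → mult p ps ≡ 0
mult-≢ p [] = refl
mult-≢ p {q ∷ qs} (p≢q ∷ all) with p ≡ᵇ q in eq
... | true = ⊥-elim (p≢q (≡ᵇ-true⇒≡ p q eq))
... | false = mult-≢ p all

mult-remove : ∀ p ps → mult p (remove p ps) ≡ 0
mult-remove p ps = mult-≢ p (All-remove {λ _ → ℕ} p (λ p≢q _ → p≢q) (All.universal (λ n → n) ps))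

times-pow-comm : ∀ p v q m → q ℕ.* times-pow p v m ≡ times-pow p v (q ℕ.* m)
times-pow-comm p zero q m = refl
times-pow-comm p (suc v) q m = trans (swap q p (times-pow p v m)) (cong (p ℕ.*_) (times-pow-comm p v q m))
  where
  swap : ∀ a b c → a ℕ.* (b ℕ.* c) ≡ b ℕ.* (a ℕ.* c)
  swap = ℕRing.solve-∀

product-remove : ∀ p ps → product ps ≡ times-pow p (mult p ps) (product (remove p ps))
product-remove p [] = refl
product-remove p (q ∷ qs) with p ≡ᵇ q in eq
... | true = cong₂ ℕ._*_ (sym (≡ᵇ-true⇒≡ p q eq)) (product-remove p qs)
... | false = trans (cong (q ℕ.*_) (product-remove p qs)) (times-pow-comm p (mult p qs) q (product (remove p qs)))

productℤ-remove : ∀ (h : ℕ → ℤ) p ps → productℤ (map h ps) ≡ h p ^ mult p ps * productℤ (map h (remove p ps))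
productℤ-remove h p [] = refl
productℤ-remove h p (q ∷ qs) with p ≡ᵇ q in eq
... | true rewrite ≡ᵇ-true⇒≡ p q eq = trans (cong (h q *_) (productℤ-remove h q qs))
  (sym (ℤ.*-assoc (h q) (h q ^ mult q qs) (productℤ (map h (remove q qs)))))
... | false = trans (cong (h q *_) (productℤ-remove h p qs))
  (swap (h q) (h p ^ mult p qs) (productℤ (map h (remove p qs))))
  where
  swap : ∀ a b c → a * (b * c) ≡ b * (a * c)
  swap = solve-∀

bounded-remove : ∀ {B ps} → All (_< suc B) ps → All (_< B) (remove B ps)
bounded-remove {B} = All-remove B λ B≢q q<1+B → ℕ.≤∧≢⇒< (ℕ.<⇒≤pred q<1+B) (B≢q ∘ sym)

prime∤product : ∀ {p ps} → Prime p → All Prime ps → All (p ≢_) ps → ¬ p ℕ.∣ product ps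
prime∤product p-prime [] [] d = ¬prime[1] (subst Prime (ℕ.∣1⇒≡1 d) p-prime)
prime∤product {p} {q ∷ qs} p-prime (q-prime ∷ primes) (p≢q ∷ all) d with euclidsLemma q (product qs) p-prime d
... | inj₂ d′ = prime∤product p-prime primes all d′
... | inj₁ p∣q with prime⇒irreducible q-prime p∣q
...   | inj₁ p≡1 = ¬prime[1] (subst Prime p≡1 p-prime)
...   | inj₂ p≡q = p≢q p≡q

prime∤product-remove : ∀ {p ps} → Prime p → All Prime ps → ¬ p ℕ.∣ product (remove p ps)
prime∤product-remove {p} {ps} p-prime primes = prime∤product p-prime (All-remove p (λ _ x → x) primes)
  (All-remove p (λ p≢q _ → p≢q) primes)

-- Counting the elements of norm n, one prime at a time.

-- `Λ n ps` is `Λ< (suc n) ps`. With the bound separated from `n`, induction can remove the largest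
-- candidate prime while the list shrinks.
Λ< : ℕ → List ℕ → ℤ
Λ< B ps = productℤ (map (lamFactor ps) (upTo B))

productℤ-∷ʳ : ∀ zs z → productℤ (zs ∷ʳ z) ≡ productℤ zs * z
productℤ-∷ʳ [] z = trans (ℤ.*-identityʳ z) (sym (ℤ.*-identityˡ z))
productℤ-∷ʳ (w ∷ zs) z = trans (cong (w *_) (productℤ-∷ʳ zs z)) (sym (ℤ.*-assoc w (productℤ zs) z))

-- The data inspected by `lamFactor` become arguments, so that each of them can be replaced by its
-- known value separately.
localFactor : Bool → ℕ → Bool → ℕ → ℤ
localFactor isPrime r is5 v =
  if isPrime ∧ (r ≡ᵇ 1) then + 1 + + v
  else if isPrime ∧ (r ≡ᵇ 2) ∧ not is5 then halfSign v
  else + 1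

lamFactor-local : ∀ ps p {isPrime r is5 v} → does (prime? p) ≡ isPrime → p % 3 ≡ r → (p ≡ᵇ 5) ≡ is5 → mult p ps ≡ v →
  lamFactor ps p ≡ localFactor isPrime r is5 v
lamFactor-local ps p refl refl refl refl = refl

-- The factor at `c < B` depends on the list only through the multiplicity of `c`, which removing
-- `B` does not change.
Λ<-suc : ∀ B ps → Λ< (suc B) ps ≡ Λ< B (remove B ps) * lamFactor ps B
Λ<-suc B ps = begin
  productℤ (map (lamFactor ps) (upTo (suc B))) ≡⟨ cong (productℤ ∘ map (lamFactor ps)) (sym (List.upTo-∷ʳ B)) ⟩
  productℤ (map (lamFactor ps) (upTo B ∷ʳ B)) ≡⟨ cong productℤ (List.map-++ (lamFactor ps) (upTo B) (B ∷ [])) ⟩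
  productℤ (map (lamFactor ps) (upTo B) ∷ʳ lamFactor ps B) ≡⟨ productℤ-∷ʳ (map (lamFactor ps) (upTo B)) _ ⟩
  Λ< B ps * lamFactor ps B ≡⟨ cong (λ zs → productℤ zs * lamFactor ps B) (List.map-cong-local (All.applyUpTo⁺₁ id B λ {c} c<B →
    lamFactor-local ps c refl refl refl (sym (mult-remove-≢ c B ps (ℕ.<⇒≢ c<B))))) ⟩
  Λ< B (remove B ps) * lamFactor ps B ∎
  where open ≡-Reasoning

mult-nonprime : ∀ {p ps} → ¬ Prime p → All Prime ps → mult p ps ≡ 0
mult-nonprime {p} ¬p primes = mult-≢ p (All.map (λ { q refl → ¬p q }) primes)

prime-multiple : ∀ {p d} .{{_ : ℕ.NonZero d}} → Prime p → d ≢ 1 → p % d ≡ 0 → d ≡ p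
prime-multiple {p} {d} p-prime d≢1 p%d with prime⇒irreducible p-prime (ℕ.m%n≡0⇒n∣m p d p%d)
... | inj₁ d≡1 = ⊥-elim (d≢1 d≡1)
... | inj₂ d≡p = d≡p

Counted : ℕ → ℤ → Set
Counted n z = Σ ℕ λ k → (R n ↔ Fin k) × + k ≡ z

-- The residue of `p` modulo 3 decides between ramified, split and inert. The prime 5 is inert but
-- has factor 1 in `Λ`; this is correct because its multiplicity is assumed even. A nonprime `p`
-- does not occur in the list.
count-factor : ∀ p ps m {z} → All Prime ps → isEven (mult 5 ps) ≡ true → (Prime p → ¬ p ℕ.∣ m) →
  Counted m z → Counted (times-pow p (mult p ps) m) (z * lamFactor ps p)
count-factor p ps m {z} primes even p∤m (k , e , k≡) = by-primality (prime? p)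
  where
  v : ℕ
  v = mult p ps
  Goal : Set
  Goal = Counted (times-pow p v m) (z * lamFactor ps p)
  factor-1 : lamFactor ps p ≡ + 1 → R m ↔ R (times-pow p v m) → Goal
  factor-1 eq e′ = k , e ↔-∘ ↔-sym e′ , trans k≡ (sym (trans (cong (z *_) eq) (ℤ.*-identityʳ z)))
  module _ (p-prime : Prime p) where
    factor≡ : ∀ {r is5} → p % 3 ≡ r → (p ≡ᵇ 5) ≡ is5 → lamFactor ps p ≡ localFactor true r is5 v
    factor≡ r≡ 5≡ = lamFactor-local ps p (dec-true (prime? p) p-prime) r≡ 5≡ refl
    by-parity : p % 3 ≡ 2 → (p ≡ᵇ 5) ≡ false → ∀ even? → isEven v ≡ even? → Goal
    by-parity r≡ 5≡ true v-even = factor-1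
      (trans (factor≡ r≡ 5≡) (cong (λ b → if b then + 1 else + 0) v-even)) (inert-even-↔ p-prime r≡ v m v-even)
    by-parity r≡ 5≡ false v-odd = 0 , empty↔Fin0 (inert-odd-empty p-prime r≡ v (p∤m p-prime) v-odd) ,
      sym (trans (cong (z *_) (trans (factor≡ r≡ 5≡) (cong (λ b → if b then + 1 else + 0) v-odd))) (ℤ.*-zeroʳ z))
    by-residue : ∀ r → p % 3 ≡ r → ∀ is5 → (p ≡ᵇ 5) ≡ is5 → Goal
    by-residue 0 r≡ _ 5≡ = factor-1 (factor≡ r≡ 5≡)
      (subst (λ q → R m ↔ R (times-pow q v m)) (prime-multiple p-prime (λ ()) r≡) (ramified-pow-↔ v m))
    by-residue 1 r≡ _ 5≡ = let a , b , Nπ = split-prime-norm p-prime r≡ in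
      suc v ℕ.* k , split-pow-↔ p-prime (a , b) Nπ (λ { refl → 0≢1 r≡ }) (p∤m p-prime) v e ,
      trans (ℤ.pos-* (suc v) k) (trans (ℤ.*-comm (+ suc v) (+ k)) (cong₂ _*_ k≡ (sym (factor≡ r≡ 5≡))))
      where
      0≢1 : 0 ≢ 1
      0≢1 ()
    by-residue 2 r≡ true 5≡ = factor-1 (factor≡ r≡ 5≡) (inert-even-↔ p-prime r≡ v m
      (subst (λ q → isEven (mult q ps) ≡ true) (sym (≡ᵇ-true⇒≡ p 5 5≡)) even))
    by-residue 2 r≡ false 5≡ = by-parity r≡ 5≡ (isEven v) refl
    by-residue (suc (suc (suc r))) r≡ _ _ = ⊥-elim (ℕ.<⇒≱ (ℕ.m%n<n p 3) (subst (3 ℕ.≤_) (sym r≡) (ℕ.m≤m+n 3 r)))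
  by-primality : Dec (Prime p) → Goal
  by-primality (yes p-prime) = by-residue p-prime (p % 3) refl (p ≡ᵇ 5) refl
  by-primality (no ¬p) = factor-1 (lamFactor-local ps p (dec-false (prime? p) ¬p) refl refl refl)
    (subst (λ v → R m ↔ R (times-pow p v m)) (sym (mult-nonprime ¬p primes)) (↔-id _))

-- Induction on a bound for the prime factors: all copies of the top candidate are split off at
-- once. The constant 6 comes from the units, at the empty list.
count : ∀ B ps → All Prime ps → All (_< B) ps → isEven (mult 5 ps) ≡ true → Counted (product ps) (+ 6 * Λ< B ps)
count zero [] _ _ _ = 6 , R1↔Fin6 , refl
count zero (_ ∷ _) _ (() ∷ _)
count (suc B) ps primes bounded even =
  subst₂ Counted (sym (product-remove B ps))
    (trans (ℤ.*-assoc (+ 6) (Λ< B (remove B ps)) (lamFactor ps B)) (cong (λ z → + 6 * z) (sym (Λ<-suc B ps))))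
    (count-factor B ps (product (remove B ps)) primes even (λ B-prime → prime∤product-remove B-prime primes)
      (count B (remove B ps) (All-remove B (λ _ x → x) primes)
        (bounded-remove bounded) even′))
  where
  even′ : isEven (mult 5 (remove B ps)) ≡ true
  even′ with 5 ℕ.≟ B
  ... | yes refl = cong isEven (mult-remove 5 ps)
  ... | no 5≢B = trans (cong isEven (mult-remove-≢ 5 B ps 5≢B)) even

-- The quadratic character modulo 5 and the sign of the theorem.

-- The Legendre symbol modulo 5 on the residues 0 to 4, with default 0 elsewhere.
legendre5 : ℕ → ℤ
legendre5 0 = + 0
legendre5 1 = + 1
legendre5 2 = - + 1
legendre5 3 = - + 1
legendre5 4 = + 1
legendre5 _ = + 0

χ₅ : ℕ → ℤ
χ₅ n = legendre5 (n % 5)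

χ₅-* : ∀ m n → χ₅ (m ℕ.* n) ≡ χ₅ m * χ₅ n
χ₅-* m n = trans (cong legendre5 (ℕ.%-distribˡ-* m n 5))
  (all-residues {5} {λ r s → legendre5 ((r ℕ.* s) % 5) ≡ legendre5 r * legendre5 s}
    (from-yes (Fin.all? {5} λ i → Fin.all? {5} λ j →
      legendre5 ((toℕ i ℕ.* toℕ j) % 5) ℤ.≟ legendre5 (toℕ i) * legendre5 (toℕ j)))
    (ℕ.m%n<n m 5) (ℕ.m%n<n n 5))

χ₅-square : ∀ m → m % 5 ≢ 0 → χ₅ m * χ₅ m ≡ + 1
χ₅-square m m%5≢0 =
  all-residues {5} {λ r _ → r ≢ 0 → legendre5 r * legendre5 r ≡ + 1}
    (λ i _ → from-yes (Fin.all? {5} λ i → ¬? (toℕ i ℕ.≟ 0) →-dec (legendre5 (toℕ i) * legendre5 (toℕ i) ℤ.≟ + 1)) i)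
    (ℕ.m%n<n m 5) (ℕ.m%n<n m 5) m%5≢0

prime[5] : Prime 5
prime[5] = from-yes (prime? 5)

-- The sign that primes q ≡ 2 (mod 3) contribute to χ₅; it cancels when their multiplicities are even.
inertSign : ℕ → ℤ
inertSign q = if q % 3 ≡ᵇ 2 then χ₅ q else + 1

inT : ℕ → Bool
inT q = (q % 15 ≡ᵇ 7) ∨ (q % 15 ≡ᵇ 13)

signOf : Bool → ℤ
signOf b = if b then - + 1 else + 1

-- The classes 7 and 13 modulo 15 are exactly those that are 1 modulo 3 and non-squares prime to 5;
-- the prime 3 is a non-square modulo 5 as well. So the signs counted in `ε` cancel `χ₅` at every
-- prime other than 5 that is not 2 modulo 3.
χ₅-prime : ∀ {q} → Prime q → 5 ≢ q → χ₅ q * (signOf (3 ≡ᵇ q) * signOf (inT q)) ≡ inertSign q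
χ₅-prime {q} q-prime 5≢q with 3 ℕ.≟ q
... | yes refl = refl
... | no 3≢q = trans (cong (λ b → χ₅ q * (signOf b * signOf (inT q))) (dec-false (3 ℕ.≟ q) 3≢q)) (subst₂
    (λ r₅ r₃ → legendre5 r₅ * (+ 1 * signOf (inT q)) ≡ (if r₃ ≡ᵇ 2 then legendre5 r₅ else + 1))
    q%5 q%3 (table (q % 15) (ℕ.m%n<n q 15)
      (λ eq → 3≢q (prime-multiple q-prime (λ ()) (trans (sym q%3) eq)))
      (λ eq → 5≢q (prime-multiple q-prime (λ ()) (trans (sym q%5) eq)))))
  where
  q%5 : q % 15 % 5 ≡ q % 5
  q%5 = ℕ.m∣n⇒o%n%m≡o%m 5 15 q (ℕ.divides 3 refl)
  q%3 : q % 15 % 3 ≡ q % 3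
  q%3 = ℕ.m∣n⇒o%n%m≡o%m 3 15 q (ℕ.divides 5 refl)
  table : ∀ r → r < 15 → r % 3 ≢ 0 → r % 5 ≢ 0 →
    legendre5 (r % 5) * (+ 1 * signOf ((r ≡ᵇ 7) ∨ (r ≡ᵇ 13))) ≡ (if r % 3 ≡ᵇ 2 then legendre5 (r % 5) else + 1)
  table r r<15 = all-residues {15} {λ r _ → r % 3 ≢ 0 → r % 5 ≢ 0 →
      legendre5 (r % 5) * (+ 1 * signOf ((r ≡ᵇ 7) ∨ (r ≡ᵇ 13))) ≡ (if r % 3 ≡ᵇ 2 then legendre5 (r % 5) else + 1)}
    (λ i _ → from-yes (Fin.all? {15} λ i → ¬? (toℕ i % 3 ℕ.≟ 0) →-dec (¬? (toℕ i % 5 ℕ.≟ 0) →-dec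
      (legendre5 (toℕ i % 5) * (+ 1 * signOf ((toℕ i ≡ᵇ 7) ∨ (toℕ i ≡ᵇ 13))) ℤ.≟
        (if toℕ i % 3 ≡ᵇ 2 then legendre5 (toℕ i % 5) else + 1)))) i) r<15 r<15

ε : List ℕ → ℤ
ε ps = (- + 1) ^ (mult 3 ps ℕ.+ countT ps)

ε-∷ : ∀ q qs → ε (q ∷ qs) ≡ (signOf (3 ≡ᵇ q) * signOf (inT q)) * ε qs
ε-∷ q qs with 3 ≡ᵇ q | inT q
... | true | true rewrite ℕ.+-suc (mult 3 qs) (countT qs) = two (ε qs)
  where
  two : ∀ x → - + 1 * (- + 1 * x) ≡ (- + 1 * - + 1) * x
  two = solve-∀
... | true | false = refl
... | false | true rewrite ℕ.+-suc (mult 3 qs) (countT qs) = refl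
... | false | false = sym (ℤ.*-identityˡ (ε qs))

mult-0⇒≢ : ∀ c ps → mult c ps ≡ 0 → All (c ≢_) ps
mult-0⇒≢ c [] _ = []
mult-0⇒≢ c (q ∷ qs) eq with c ≡ᵇ q in c≡q
... | false = ≡ᵇ-false⇒≢ c q c≡q ∷ mult-0⇒≢ c qs eq

χ₅-product : ∀ {ps} → All Prime ps → All (5 ≢_) ps → χ₅ (product ps) * ε ps ≡ productℤ (map inertSign ps)
χ₅-product [] [] = refl
χ₅-product {q ∷ qs} (q-prime ∷ primes) (5≢q ∷ all) = begin
  χ₅ (q ℕ.* product qs) * ε (q ∷ qs) ≡⟨ cong₂ _*_ (χ₅-* q (product qs)) (ε-∷ q qs) ⟩
  (χ₅ q * χ₅ (product qs)) * (s * ε qs) ≡⟨ rearrange (χ₅ q) (χ₅ (product qs)) s (ε qs) ⟩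
  (χ₅ q * s) * (χ₅ (product qs) * ε qs) ≡⟨ cong₂ _*_ (χ₅-prime q-prime 5≢q) (χ₅-product primes all) ⟩
  inertSign q * productℤ (map inertSign qs) ∎
  where
  open ≡-Reasoning
  s : ℤ
  s = signOf (3 ≡ᵇ q) * signOf (inT q)
  rearrange : ∀ a b c d → (a * b) * (c * d) ≡ (a * c) * (b * d)
  rearrange = solve-∀

even-power : ∀ z v → z * z ≡ + 1 → isEven v ≡ true → z ^ v ≡ + 1
even-power z zero _ _ = refl
even-power z (suc (suc v)) z² even = trans (sym (ℤ.*-assoc z z (z ^ v)))
  (trans (cong₂ _*_ z² (even-power z v z² even)) refl)

-- An odd multiplicity of an inert prime other than 5 makes `Λ` vanish, and an even one squares its
-- sign away.
inertSign-power : ∀ p ps → All Prime ps → All (5 ≢_) ps →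
  lamFactor ps p ≡ + 0 ⊎ inertSign p ^ mult p ps ≡ + 1
inertSign-power p ps primes ≢5 = by-primality (prime? p) (5 ℕ.≟ p)
  where
  by-parity : Prime p → 5 ≢ p → ∀ even? → isEven (mult p ps) ≡ even? → ∀ two? → (p % 3 ≡ᵇ 2) ≡ two? →
    lamFactor ps p ≡ + 0 ⊎ inertSign p ^ mult p ps ≡ + 1
  by-parity _ _ _ _ false eq = inj₂ (trans (cong (λ b → (if b then χ₅ p else + 1) ^ mult p ps) eq) (ℤ.^-zeroˡ (mult p ps)))
  by-parity p-prime 5≢p true even true eq = inj₂ (trans (cong (λ b → (if b then χ₅ p else + 1) ^ mult p ps) eq)
    (even-power (χ₅ p) (mult p ps) (χ₅-square p (λ p%5 → 5≢p (prime-multiple p-prime (λ ()) p%5))) even))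
  by-parity p-prime 5≢p false odd true eq = inj₁ (trans
    (lamFactor-local ps p (dec-true (prime? p) p-prime) (≡ᵇ-true⇒≡ (p % 3) 2 eq) (dec-false (p ℕ.≟ 5) (5≢p ∘ sym)) refl)
    (cong (λ b → if b then + 1 else + 0) odd))
  by-primality : Dec (Prime p) → Dec (5 ≡ p) → lamFactor ps p ≡ + 0 ⊎ inertSign p ^ mult p ps ≡ + 1
  by-primality (no ¬p) _ = inj₂ (cong (inertSign p ^_) (mult-nonprime ¬p primes))
  by-primality (yes _) (yes refl) = inj₂ (cong (inertSign 5 ^_) (mult-≢ 5 ≢5))
  by-primality (yes p-prime) (no 5≢p) = by-parity p-prime 5≢p _ refl _ refl

Λ<-zero-or-sign : ∀ B ps → All Prime ps → All (_< B) ps → All (5 ≢_) ps →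
  Λ< B ps ≡ + 0 ⊎ productℤ (map inertSign ps) ≡ + 1
Λ<-zero-or-sign zero [] _ _ _ = inj₂ refl
Λ<-zero-or-sign zero (_ ∷ _) _ (() ∷ _)
Λ<-zero-or-sign (suc B) ps primes bounded ≢5
  with Λ<-zero-or-sign B (remove B ps) (All-remove B (λ _ x → x) primes)
         (bounded-remove bounded) (All-remove B (λ _ x → x) ≢5)
     | inertSign-power B ps primes ≢5
... | inj₁ Λ≡0 | _ = inj₁ (trans (Λ<-suc B ps) (cong (_* lamFactor ps B) Λ≡0))
... | inj₂ _ | inj₁ factor≡0 = inj₁ (trans (Λ<-suc B ps)
      (trans (cong (Λ< B (remove B ps) *_) factor≡0) (ℤ.*-zeroʳ (Λ< B (remove B ps)))))
... | inj₂ rest≡1 | inj₂ power≡1 = inj₂ (trans (productℤ-remove inertSign B ps) (cong₂ _*_ power≡1 rest≡1))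

-- This links the sign `(-1)^(a+t)` to the character: where `Λ<` does not vanish, all inert signs
-- cancel, so `ε ps` is the character of the product.
χ₅-ε : ∀ B ps → All Prime ps → All (_< B) ps → mult 5 ps ≡ 0 →
  Λ< B ps ≡ + 0 ⊎ χ₅ (product ps) * ε ps ≡ + 1
χ₅-ε B ps primes bounded no5 = Sum.map₂ (trans (χ₅-product primes ≢5)) (Λ<-zero-or-sign B ps primes bounded ≢5)
  where
  ≢5 : All (5 ≢_) ps
  ≢5 = mult-0⇒≢ 5 ps no5

-- Sublattices of index 5 and the rotation of order 3.

-- A line of 𝔽₅² is encoded by the coefficients of a linear form vanishing on it, and the sublattice
-- over it by `+ 5 ∣ L c d u`.
L : ℤ → ℤ → ℤ × ℤ → ℤ
L c d (x , y) = c * x + d * y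

-- Multiplication by the cube root of unity `ζ² = ζ - 1`.
ω : ℤ × ℤ → ℤ × ℤ
ω (x , y) = - x - y , x

ω³ : ∀ u → ω (ω (ω u)) ≡ u
ω³ (x , y) = cong₂ _,_ (identity₁ x y) (identity₂ x y)
  where
  identity₁ : ∀ x y → - (- (- x - y) - x) - (- x - y) ≡ x
  identity₁ = solve-∀
  identity₂ : ∀ x y → - (- x - y) - x ≡ y
  identity₂ = solve-∀

norm-ω : ∀ u → norm (ω u) ≡ norm u
norm-ω (x , y) = identity x y
  where
  identity : ∀ x y → (- x - y) * (- x - y) + (- x - y) * x + x * x ≡ x * x + x * y + y * y
  identity = solve-∀

-- The transpose of `ω` acts on coefficients by sending `(c , d)` to `(d - c , - c)`; iterating it
-- yields the other two lines of the orbit.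
L-ω : ∀ c d u → L c d (ω u) ≡ L (d - c) (- c) u
L-ω c d (x , y) = identity c d x y
  where
  identity : ∀ c d x y → c * (- x - y) + d * x ≡ (d - c) * x + - c * y
  identity = solve-∀

residues : ℤ × ℤ → ℤ × ℤ
residues (x , y) = + (x ℤ.%ℕ 5) , + (y ℤ.%ℕ 5)

L-residues : ∀ c d u → + 5 ∣ L c d u - L c d (residues u)
L-residues c d (x , y) = divides (c * q + d * q′) (trans
  (cong₂ (λ x y → c * x + d * y - (c * r + d * s)) (ℤ.a≡a%ℕn+[a/ℕn]*n x 5) (ℤ.a≡a%ℕn+[a/ℕn]*n y 5))
  (identity c d r q s q′))
  where
  r q s q′ : ℤ
  r = + (x ℤ.%ℕ 5)
  q = x ℤ./ℕ 5
  s = + (y ℤ.%ℕ 5)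
  q′ = y ℤ./ℕ 5
  identity : ∀ c d r q s q′ → c * (r + q * + 5) + d * (s + q′ * + 5) - (c * r + d * s) ≡ (c * q + d * q′) * + 5
  identity = solve-∀

∣L⇒∣L-residues : ∀ c d u → + 5 ∣ L c d u → + 5 ∣ L c d (residues u)
∣L⇒∣L-residues c d u p = subst (+ 5 ∣_) (identity (L c d u) (L c d (residues u))) (∣m∣n⇒∣m-n p (L-residues c d u))
  where
  identity : ∀ a b → a - (a - b) ≡ b
  identity = solve-∀

∣L-residues⇒∣L : ∀ c d u → + 5 ∣ L c d (residues u) → + 5 ∣ L c d u
∣L-residues⇒∣L c d u p = subst (+ 5 ∣_) (identity (L c d u) (L c d (residues u))) (∣m∣n⇒∣m+n (L-residues c d u) p)
  where
  identity : ∀ a b → a - b + b ≡ a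
  identity = solve-∀

-- The lines are the kernel of `L c d` and its preimages under `ω` and `ω²`. Distinct lines meet
-- only in the origin, and along one line norms differ by squares, so the character is constant off
-- the origin. For given coefficients all three fields are decided by evaluation on 25 pairs.
record LineChecks (c d s : ℤ) : Set where
  field
    disjoint : ∀ (i j : Fin 5) → + 5 ∣ L c d (+ toℕ i , + toℕ j) → + 5 ∣ L (d - c) (- c) (+ toℕ i , + toℕ j) →
               χ₅ (Nℕ (toℕ i) (toℕ j)) ≡ + 0
    cover    : ∀ (i j : Fin 5) → χ₅ (Nℕ (toℕ i) (toℕ j)) ≡ s →
               (+ 5 ∣ L c d (+ toℕ i , + toℕ j) ⊎ + 5 ∣ L (d - c) (- c) (+ toℕ i , + toℕ j))
               ⊎ + 5 ∣ L (- c - (d - c)) (- (d - c)) (+ toℕ i , + toℕ j)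
    excluded : ∀ (i j : Fin 5) → + 5 ∣ L c d (+ toℕ i , + toℕ j) → χ₅ (Nℕ (toℕ i) (toℕ j)) ≢ - s

-- ι identifies the lattice carrying the form F with the sublattice 5 ∣ cx + dy of ℤ[ζ]. The latter and its
-- two rotations are three of the six lines of 𝔽₅², namely those on which the norm has quadratic character s.
record SublatticeForm (F : ℤ × ℤ → ℤ) (s : ℤ) : Set where
  field
    c d : ℤ
    ι : ℤ × ℤ → ℤ × ℤ
    norm-ι : ∀ w → norm (ι w) ≡ F w
    ι-injective : ∀ v w → ι v ≡ ι w → v ≡ w
    ∣L-ι : ∀ w → + 5 ∣ L c d (ι w)
    ι-surjective : ∀ u → + 5 ∣ L c d u → ∃ λ w → ι w ≡ u
    lineChecks : LineChecks c d s

module _ {F : ℤ × ℤ → ℤ} {s : ℤ} (Φ : SublatticeForm F s) {n : ℕ} where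
  open SublatticeForm Φ
  open LineChecks lineChecks

  private
    X : Set
    X = Σ (ℤ × ℤ) λ w → F w ≡ + n

    X-≡ : {v w : X} → proj₁ v ≡ proj₁ w → v ≡ w
    X-≡ {v , p} {.v , q} refl = cong (v ,_) (≡-irrelevant p q)

    toR : X → R n
    toR (w , Fw) = ι w , trans (norm-ι w) Fw

    toR-injective : ∀ {v w} → toR v ≡ toR w → v ≡ w
    toR-injective {v} {w} eq = X-≡ (ι-injective (proj₁ v) (proj₁ w) (cong proj₁ eq))

    fromR : (u : R n) → + 5 ∣ L c d (proj₁ u) → ∃ λ w → toR w ≡ u
    fromR (u , Nu) p = let w , eq = ι-surjective u p in
      (w , trans (sym (norm-ι w)) (trans (cong norm eq) Nu)) , R-≡ eq

    at-residues : ∀ {P : ℕ → ℕ → Set} → (∀ (i j : Fin 5) → P (toℕ i) (toℕ j)) → (u : ℤ × ℤ) →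
      P (proj₁ u ℤ.%ℕ 5) (proj₂ u ℤ.%ℕ 5)
    at-residues {P} all (x , y) = all-residues {5} {P} all (ℤ.n%ℕd<d x 5) (ℤ.n%ℕd<d y 5)

    χ₅-norm : (u : R n) → χ₅ (Nℕ (proj₁ (proj₁ u) ℤ.%ℕ 5) (proj₂ (proj₁ u) ℤ.%ℕ 5)) ≡ χ₅ n
    χ₅-norm ((x , y) , Nu) = cong legendre5 (norm-mod 5 x y n Nu)

    σ : R n → R n
    σ (u , Nu) = ω u , trans (norm-ω u) Nu

  opposite-character⇒empty : χ₅ n ≡ - s → ¬ X
  opposite-character⇒empty χ≡ x = let u = toR x in
    at-residues {λ r t → + 5 ∣ L c d (+ r , + t) → χ₅ (Nℕ r t) ≢ - s} excluded (proj₁ u)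
      (∣L⇒∣L-residues c d (proj₁ u) (∣L-ι (proj₁ x))) (trans (χ₅-norm u) χ≡)

  R-empty⇒empty : ¬ R n → ¬ X
  R-empty⇒empty ¬R = ¬R ∘ toR

  multiples-of-5-↔ : (∀ (u : R n) → + 5 ∣ proj₁ (proj₁ u) × + 5 ∣ proj₂ (proj₁ u)) → X ↔ R n
  multiples-of-5-↔ divisible = bijective⇒↔ toR toR-injective λ u → let 5∣x , 5∣y = divisible u in
    fromR u (∣m∣n⇒∣m+n (∣n⇒∣m*n c 5∣x) (∣n⇒∣m*n d 5∣y))

  -- The form's elements are a transversal for the rotation `σ` on `R n`: the three lines cover the
  -- character `s`, and an element on two of them would have character 0. An element on a rotated
  -- line is first turned by `σ` or its square into the sublattice of the form.
  same-character-↔ : χ₅ n ≡ s → s ≢ + 0 → (Fin 3 × X) ↔ R n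
  same-character-↔ χ≡ s≢0 = orbits↔ σ (λ u → R-≡ (ω³ (proj₁ u))) toR toR-injective disjoint′ cover′
    where
    disjoint′ : ∀ v w → toR v ≢ σ (toR w)
    disjoint′ v w eq = let u = toR w in s≢0 (trans (sym (trans (χ₅-norm u) χ≡))
      (at-residues {λ r t → + 5 ∣ L c d (+ r , + t) → + 5 ∣ L (d - c) (- c) (+ r , + t) → χ₅ (Nℕ r t) ≡ + 0}
        disjoint (proj₁ u)
        (∣L⇒∣L-residues c d (proj₁ u) (∣L-ι (proj₁ w)))
        (∣L⇒∣L-residues (d - c) (- c) (proj₁ u)
          (subst (+ 5 ∣_) (trans (cong (L c d ∘ proj₁) eq) (L-ω c d (proj₁ u))) (∣L-ι (proj₁ v))))))
    cover′ : ∀ u → Σ X λ w → (toR w ≡ u ⊎ toR w ≡ σ u) ⊎ toR w ≡ σ (σ u)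
    cover′ u = choose (at-residues {λ r t → χ₅ (Nℕ r t) ≡ s →
               (+ 5 ∣ L c d (+ r , + t) ⊎ + 5 ∣ L (d - c) (- c) (+ r , + t))
               ⊎ + 5 ∣ L (- c - (d - c)) (- (d - c)) (+ r , + t)} cover (proj₁ u) (trans (χ₅-norm u) χ≡))
      where
      u₀ : ℤ × ℤ
      u₀ = proj₁ u
      choose : (+ 5 ∣ L c d (residues u₀) ⊎ + 5 ∣ L (d - c) (- c) (residues u₀))
               ⊎ + 5 ∣ L (- c - (d - c)) (- (d - c)) (residues u₀) →
               Σ X λ w → (toR w ≡ u ⊎ toR w ≡ σ u) ⊎ toR w ≡ σ (σ u)
      choose (inj₁ (inj₁ p)) = let w , eq = fromR u (∣L-residues⇒∣L c d u₀ p) in w , inj₁ (inj₁ eq)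
      choose (inj₁ (inj₂ p)) =
        let w , eq = fromR (σ u) (subst (+ 5 ∣_) (sym (L-ω c d u₀)) (∣L-residues⇒∣L (d - c) (- c) u₀ p))
        in w , inj₁ (inj₂ eq)
      choose (inj₂ p) =
        let w , eq = fromR (σ (σ u)) (subst (+ 5 ∣_) (sym (trans (L-ω c d (ω u₀)) (L-ω (d - c) (- c) u₀)))
                       (∣L-residues⇒∣L (- c - (d - c)) (- (d - c)) u₀ p))
        in w , inj₂ eq

-- Counting the representations by a sublattice form.

IsSign : ℤ → Set
IsSign s = s ≡ + 1 ⊎ s ≡ - + 1

-1^-isSign : ∀ n → IsSign ((- + 1) ^ n)
-1^-isSign zero = inj₁ refl
-1^-isSign (suc n) = Sum.swap (Sum.map (cong (λ z → - + 1 * z)) (cong (λ z → - + 1 * z)) (-1^-isSign n))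

χ*ε≡1⇒χ≡ε : ∀ {χ e} → IsSign e → χ * e ≡ + 1 → χ ≡ e
χ*ε≡1⇒χ≡ε {χ} (inj₁ refl) eq = trans (sym (ℤ.*-identityʳ χ)) eq
χ*ε≡1⇒χ≡ε {χ} (inj₂ refl) eq = trans (identity χ) (cong -_ eq)
  where
  identity : ∀ χ → χ ≡ - (χ * - + 1)
  identity = solve-∀

primes-≤-product : ∀ {ps} → All Prime ps → All (_< suc (product ps)) ps
primes-≤-product {ps} primes = All.tabulate λ {q} q∈ps →
  ℕ.s≤s (ℕ.∣⇒≤ {{productOfPrimes≢0 primes}} (∈⇒∣product q∈ps))

-- If 5 does not divide `n` and `Λ` is nonzero, then `χ₅ n` equals `ε ps`. When this agrees with
-- `s`, a third of `6Λ` is `2Λ = (1 + s ε) Λ`; when it is opposite, both sides are 0. If 5 divides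
-- `n`, every element of norm `n` is a multiple of 5 and lies in the sublattice, and an odd power of
-- 5 admits no such element.
sublattice-representations : ∀ {F s} → SublatticeForm F s → IsSign s → ∀ {ps} → All Prime ps →
  Σ ℕ λ k → (Σ (ℤ × ℤ) (λ w → F w ≡ + product ps) ↔ Fin k) ×
    + k ≡ byB (mult 5 ps) ((+ 1 + s * ε ps) * Λ (product ps) ps) (+ 6 * Λ (product ps) ps)
sublattice-representations {F} {s} Φ s-sign {ps} primes = by-mult5 (mult 5 ps) refl
  where
  n : ℕ
  n = product ps
  λn e : ℤ
  λn = Λ n ps
  e = ε ps
  X : Set
  X = Σ (ℤ × ℤ) λ w → F w ≡ + n
  Counts : ℤ → Set
  Counts z = Σ ℕ λ k → (X ↔ Fin k) × + k ≡ z
  nothing : ¬ X → ∀ {z} → z ≡ + 0 → Counts z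
  nothing ¬X z≡0 = 0 , empty↔Fin0 ¬X , sym z≡0
  counted : isEven (mult 5 ps) ≡ true → Counted n (+ 6 * λn)
  counted = count (suc n) ps primes (primes-≤-product primes)

  unramified : Counted n (+ 6 * λn) → λn ≡ + 0 ⊎ χ₅ n * e ≡ + 1 → Counts ((+ 1 + s * e) * λn)
  unramified (k , E , k≡) (inj₁ λ≡0) = nothing
    (R-empty⇒empty Φ (λ u → Fin.¬Fin0 (subst Fin (ℤ.+-injective (trans k≡ (cong (λ z → + 6 * z) λ≡0))) (Inverse.to E u))))
    (trans (cong ((+ 1 + s * e) *_) λ≡0) (ℤ.*-zeroʳ (+ 1 + s * e)))
  unramified (k , E , k≡) (inj₂ χe≡1) = by-signs s-sign (-1^-isSign (mult 3 ps ℕ.+ countT ps))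
    where
    χ≡e : χ₅ n ≡ e
    χ≡e = χ*ε≡1⇒χ≡ε (-1^-isSign (mult 3 ps ℕ.+ countT ps)) χe≡1
    same : χ₅ n ≡ s → s ≢ + 0 → s * e ≡ + 1 → Counts ((+ 1 + s * e) * λn)
    same χ≡s s≢0 se≡1 =
      let k′ , E′ , k≡3k′ = divide-card-by-3 (E ↔-∘ same-character-↔ Φ χ≡s s≢0)
      in k′ , E′ , trans (ℤ.*-cancelˡ-≡ (+ 3) (+ k′) (+ 2 * λn)
           (trans (sym (ℤ.pos-* 3 k′)) (trans (cong +_ (sym k≡3k′)) (trans k≡ (ℤ.*-assoc (+ 3) (+ 2) λn)))))
           (cong (λ z → (+ 1 + z) * λn) (sym se≡1))
    opposite : χ₅ n ≡ - s → s * e ≡ - + 1 → Counts ((+ 1 + s * e) * λn)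
    opposite χ≡-s se≡-1 = nothing (opposite-character⇒empty Φ χ≡-s) (cong (λ z → (+ 1 + z) * λn) se≡-1)
    by-signs : IsSign s → IsSign e → Counts ((+ 1 + s * e) * λn)
    by-signs (inj₁ s≡) (inj₁ e≡) = same (trans χ≡e (trans e≡ (sym s≡))) (λ s≡0 → 1≢0 (trans (sym s≡) s≡0)) (cong₂ _*_ s≡ e≡)
      where
      1≢0 : + 1 ≢ + 0
      1≢0 ()
    by-signs (inj₁ s≡) (inj₂ e≡) = opposite (trans χ≡e (trans e≡ (cong -_ (sym s≡)))) (cong₂ _*_ s≡ e≡)
    by-signs (inj₂ s≡) (inj₁ e≡) = opposite (trans χ≡e (trans e≡ (cong -_ (sym s≡)))) (cong₂ _*_ s≡ e≡)
    by-signs (inj₂ s≡) (inj₂ e≡) = same (trans χ≡e (trans e≡ (sym s≡))) (λ s≡0 → -1≢0 (trans (sym s≡) s≡0)) (cong₂ _*_ s≡ e≡)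
      where
      -1≢0 : - + 1 ≢ + 0
      -1≢0 ()

  n≡ : ∀ {v} → mult 5 ps ≡ v → n ≡ times-pow 5 v (product (remove 5 ps))
  n≡ eq = trans (product-remove 5 ps) (cong (λ v → times-pow 5 v (product (remove 5 ps))) eq)

  5∣ : ∀ {b} → mult 5 ps ≡ suc b → (u : R n) → + 5 ∣ proj₁ (proj₁ u) × + 5 ∣ proj₂ (proj₁ u)
  5∣ {b} eq ((x , y) , Nu) = inert-∣ prime[5] refl x y
    (*-∣ {5} {times-pow 5 b (product (remove 5 ps))} (trans Nu (cong +_ (n≡ eq))))

  by-parity : ∀ b → mult 5 ps ≡ suc b → ∀ even? → isEven (suc b) ≡ even? →
    Counts (if even? then + 6 * λn else + 0)
  by-parity b eq true even = let k , E , k≡ = counted (trans (cong isEven eq) even) in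
    k , E ↔-∘ multiples-of-5-↔ Φ (5∣ eq) , k≡
  by-parity b eq false odd = nothing (R-empty⇒empty Φ (λ u → inert-odd-empty prime[5] refl (suc b)
    (prime∤product-remove prime[5] primes) odd (subst R (n≡ eq) u))) refl

  by-mult5 : ∀ v → mult 5 ps ≡ v → Counts (byB v ((+ 1 + s * e) * λn) (+ 6 * λn))
  by-mult5 zero eq = unramified (counted (cong isEven eq)) (χ₅-ε (suc n) ps primes (primes-≤-product primes) eq)
  by-mult5 (suc b) eq = by-parity b eq (isEven (suc b)) refl

-- The two forms as sublattices of ℤ[ζ].

shear-injective : ∀ u v u′ v′ → u - + 2 * v ≡ u′ - + 2 * v′ → v ≡ v′ → (u , v) ≡ (u′ , v′)
shear-injective u v u′ .v eq refl =
  cong (_, v) (trans (sym (unshear u v)) (trans (cong (_+ + 2 * v) eq) (unshear u′ v)))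
  where
  unshear : ∀ u v → u - + 2 * v + + 2 * v ≡ u
  unshear = solve-∀

-- The sublattice `5 ∣ y` has basis `1` and `-2 + 5ζ`, of norms 1 and 19. As 1 is a square modulo 5,
-- the character is `+ 1`.
form1-1-19 : SublatticeForm (λ w → form (+ 1) (+ 1) (+ 19) (proj₁ w) (proj₂ w)) (+ 1)
form1-1-19 = record
  { c = + 0
  ; d = + 1
  ; ι = λ (u , v) → u - + 2 * v , + 5 * v
  ; norm-ι = λ (u , v) → identity u v
  ; ι-injective = λ (u , v) (u′ , v′) eq → shear-injective u v u′ v′
      (cong proj₁ eq) (ℤ.*-cancelˡ-≡ (+ 5) v v′ (cong proj₂ eq))
  ; ∣L-ι = λ (u , v) → divides v (multiple u v)
  ; ι-surjective = λ { (x , y) (divides q eq) → (x + + 2 * q , q) ,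
      cong₂ _,_ (first x q) (trans (ℤ.*-comm (+ 5) q) (trans (sym eq) (second x y))) }
  ; lineChecks = record
      -- The coefficient pairs (1, 0) and (-1, -1) arise from (0, 1) by one and two applications of
      -- the transposed rotation.
      { disjoint = from-yes (Fin.all? {5} λ i → Fin.all? {5} λ j → (+ 5 ∣? L (+ 0) (+ 1) (+ toℕ i , + toℕ j))
          →-dec ((+ 5 ∣? L (+ 1) (+ 0) (+ toℕ i , + toℕ j)) →-dec (χ₅ (Nℕ (toℕ i) (toℕ j)) ℤ.≟ + 0)))
      ; cover = from-yes (Fin.all? {5} λ i → Fin.all? {5} λ j → (χ₅ (Nℕ (toℕ i) (toℕ j)) ℤ.≟ + 1)
          →-dec (((+ 5 ∣? L (+ 0) (+ 1) (+ toℕ i , + toℕ j)) ⊎-dec (+ 5 ∣? L (+ 1) (+ 0) (+ toℕ i , + toℕ j)))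
          ⊎-dec (+ 5 ∣? L (- + 1) (- + 1) (+ toℕ i , + toℕ j))))
      ; excluded = from-yes (Fin.all? {5} λ i → Fin.all? {5} λ j → (+ 5 ∣? L (+ 0) (+ 1) (+ toℕ i , + toℕ j))
          →-dec ¬? (χ₅ (Nℕ (toℕ i) (toℕ j)) ℤ.≟ - + 1))
      }
  }
  where
  identity : ∀ u v → (u - + 2 * v) * (u - + 2 * v) + (u - + 2 * v) * (+ 5 * v) + (+ 5 * v) * (+ 5 * v)
    ≡ + 1 * (u * u) + + 1 * (u * v) + + 19 * (v * v)
  identity = solve-∀
  multiple : ∀ u v → + 0 * (u - + 2 * v) + + 1 * (+ 5 * v) ≡ v * + 5
  multiple = solve-∀
  first : ∀ x q → x + + 2 * q - + 2 * q ≡ x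
  first = solve-∀
  second : ∀ x y → + 0 * x + + 1 * y ≡ y
  second = solve-∀

-- The sublattice `5 ∣ y - x` has basis `1 + ζ` and `-2 + 3ζ`, of norms 3 and 7. As 3 is a
-- non-square modulo 5, the character is `- + 1`.
form3-3-7 : SublatticeForm (λ w → form (+ 3) (+ 3) (+ 7) (proj₁ w) (proj₂ w)) (- + 1)
form3-3-7 = record
  { c = - + 1
  ; d = + 1
  ; ι = λ (u , v) → u - + 2 * v , u + + 3 * v
  ; norm-ι = λ (u , v) → identity u v
  ; ι-injective = λ (u , v) (u′ , v′) eq → shear-injective u v u′ v′ (cong proj₁ eq)
      (ℤ.*-cancelˡ-≡ (+ 5) v v′ (trans (difference u v)
        (trans (cong₂ _-_ (cong proj₂ eq) (cong proj₁ eq)) (sym (difference u′ v′)))))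
  ; ∣L-ι = λ (u , v) → divides v (multiple u v)
  ; ι-surjective = λ { (x , y) (divides q eq) → (x + + 2 * q , q) ,
      cong₂ _,_ (first x q) (trans (second x q) (trans (cong (λ z → x + z) (sym eq)) (third x y))) }
  ; lineChecks = record
      { disjoint = from-yes (Fin.all? {5} λ i → Fin.all? {5} λ j → (+ 5 ∣? L (- + 1) (+ 1) (+ toℕ i , + toℕ j))
          →-dec ((+ 5 ∣? L (+ 2) (+ 1) (+ toℕ i , + toℕ j)) →-dec (χ₅ (Nℕ (toℕ i) (toℕ j)) ℤ.≟ + 0)))
      ; cover = from-yes (Fin.all? {5} λ i → Fin.all? {5} λ j → (χ₅ (Nℕ (toℕ i) (toℕ j)) ℤ.≟ - + 1)
          →-dec (((+ 5 ∣? L (- + 1) (+ 1) (+ toℕ i , + toℕ j)) ⊎-dec (+ 5 ∣? L (+ 2) (+ 1) (+ toℕ i , + toℕ j)))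
          ⊎-dec (+ 5 ∣? L (- + 1) (- + 2) (+ toℕ i , + toℕ j))))
      ; excluded = from-yes (Fin.all? {5} λ i → Fin.all? {5} λ j → (+ 5 ∣? L (- + 1) (+ 1) (+ toℕ i , + toℕ j))
          →-dec ¬? (χ₅ (Nℕ (toℕ i) (toℕ j)) ℤ.≟ + 1))
      }
  }
  where
  identity : ∀ u v → (u - + 2 * v) * (u - + 2 * v) + (u - + 2 * v) * (u + + 3 * v) + (u + + 3 * v) * (u + + 3 * v)
    ≡ + 3 * (u * u) + + 3 * (u * v) + + 7 * (v * v)
  identity = solve-∀
  difference : ∀ u v → + 5 * v ≡ (u + + 3 * v) - (u - + 2 * v)
  difference = solve-∀
  multiple : ∀ u v → - + 1 * (u - + 2 * v) + + 1 * (u + + 3 * v) ≡ v * + 5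
  multiple = solve-∀
  first : ∀ x q → x + + 2 * q - + 2 * q ≡ x
  first = solve-∀
  second : ∀ x q → x + + 2 * q + + 3 * q ≡ x + q * + 5
  second = solve-∀
  third : ∀ x y → x + (- + 1 * x + + 1 * y) ≡ y
  third = solve-∀

theorem4p2 : (n : ℕ) (ps : List ℕ) → All Prime ps → product ps ≡ n →
    (Σ ℕ λ k → (Reps (+ 1) (+ 1) (+ 19) (+ n) ↔ Fin k) × (+ k ≡ rhs1-1-19 n ps))
    × (Σ ℕ λ k → (Reps (+ 3) (+ 3) (+ 7) (+ n) ↔ Fin k) × (+ k ≡ rhs3-3-7 n ps))
theorem4p2 _ ps primes refl = principal , other
  where
  n : ℕ
  n = product ps
  rhs : ℤ → ℤ
  rhs z = byB (mult 5 ps) ((+ 1 + z) * Λ n ps) (+ 6 * Λ n ps)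
  principal : Σ ℕ λ k → (Reps (+ 1) (+ 1) (+ 19) (+ n) ↔ Fin k) × (+ k ≡ rhs1-1-19 n ps)
  principal = let k , E , k≡ = sublattice-representations form1-1-19 (inj₁ refl) primes in
    k , E , trans k≡ (cong rhs (ℤ.*-identityˡ (ε ps)))
  other : Σ ℕ λ k → (Reps (+ 3) (+ 3) (+ 7) (+ n) ↔ Fin k) × (+ k ≡ rhs3-3-7 n ps)
  other = let k , E , k≡ = sublattice-representations form3-3-7 (inj₂ refl) primes in
    k , E , trans k≡ (cong rhs (ℤ.-1*i≡-i (ε ps)))
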